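{- Let $\mathcal I$ be an interpretation of a circuit signature $\Sigma$. Then observational equivalence $\sim_{\mathcal I}$ is the largest adequate congruence on $\mathbf{SCirc}_\Sigma$.
   Context: Circuits. A circuit signature $\Sigma$ consists of a finite set $\mathbf V$ of values with a distinguished value $\bullet$, a set $\mathcal P$ of primitive symbols, and functions $\mathrm{dom},\mathrm{cod}\colon\mathcal P\to\mathbb N$. A PROP is a strict symmetric monoidal category with objects $\mathbb N$ and addition as tensor on objects. $\mathbf{CCirc}_\Sigma$ is the PROP freely generated by: $p\colon\mathrm{dom}(p)\to\mathrm{cod}(p)$ for $p\in\mathcal P$, a fork $1\to2$, a join $2\to1$, an introduction $\bullet\colon0\to1$, and an elimination $1\to0$; its morphisms are combinational circuits. $\mathbf{SCirc}_\Sigma$ is the symmetric traced PROP freely generated by these together with a value $v\colon0\to1$ for each $v\in\mathbf V\setminus\{\bullet\}$ and a delay $\delta\colon1\to1$ (the "value" $\bullet$ means the introduction generator); its morphisms are sequential circuits, taken modulo the axioms of symmetric traced monoidal categories. Composition $f;g$ is in diagrammatic order; $\mathrm{Tr}^x$ sends $x+m\to x+n$ to $m\to n$. $\mathrm{fork}_n,\mathrm{join}_n,\mathrm{elim}_n,\bullet_n,\delta_n$ and $\overline v\colon0\to n$ ($\overline v\in\mathbf V^n$) are the wirewise versions on $n$ wires; $\mathrm{reg}(\overline v)\coloneqq(\overline v\otimes\delta_n);\mathrm{join}_n\colon n\to n$. An interpretation $\mathcal I$ is a lattice order on $\mathbf V$ with $\bullet$ least (also written $\bot$) and join $\sqcup$,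 and for each $p\in\mathcal P$ a $\bot$-preserving monotone function $[\![p]\!]\colon\mathbf V^{\mathrm{dom}(p)}\to\mathbf V^{\mathrm{cod}(p)}$. Denotation. $[\![-]\!]^{\mathsf S}_{\mathcal I}$ is the traced PROP morphism sending circuits $m\to n$ to causal, monotone, finitely specified stream functions $(\mathbf V^m)^\omega\to(\mathbf V^n)^\omega$ determined by: primitives act elementwise by $[\![p]\!]$; fork copies; join is the elementwise $\sqcup$; introduction is the constant stream $\bot$; elimination discards; $v\mapsto v::\bot::\bot::\cdots$; $\delta\mapsto(\sigma\mapsto\bot::\sigma)$; the trace of $f\colon(\mathbf V^{x+m})^\omega\to(\mathbf V^{x+n})^\omega$ is $\sigma\mapsto\pi_1(f(\mu_f(\sigma),\sigma))$, with $\mu_f(\sigma)$ the least fixed point of $\tau\mapsto\pi_0(f(\tau,\sigma))$. Reduction rules (applied to subcircuits, modulo axioms of symmetric traced monoidal categories). (Mealy): for combinational $\hat f\colon x+y+z+m\to x+y+n$ and $\overline v\in\mathbf V^z$, a circuit in global trace-delay form $\mathrm{Tr}^{x+y}\big((\mathrm{id}_x\otimes\delta_y\otimes\overline v\otimes\mathrm{id}_m);\hat f\big)$ rewrites to $\mathrm{Tr}^{x+y+z}\big((\mathrm{id}_x\otimes\mathrm{reg}(\bot^y\overline v)\otimes\mathrm{id}_m);\hat f;(\mathrm{id}_{x+y}\otimes\bullet_z\otimes\mathrm{id}_n)\big)$. Every sequential circuit is equal to one in global trace-delay form. (IF): for combinational $h\colon x+a\to x+b$, $\mathrm{Tr}^x(h)\rightsquigarrow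 h^\dagger;(\mathrm{elim}_x\otimes\mathrm{id}_b)$, where $h^0\coloneqq(\bullet_x\otimes\mathrm{id}_a);h$, $h^{k+1}\coloneqq\mathrm{fork}_a;\big((h^k;(\mathrm{id}_x\otimes\mathrm{elim}_b))\otimes\mathrm{id}_a\big);h$, and $h^\dagger\coloneqq h^{d+1}$ with $d$ the length of the longest chain in $\mathbf V^x$. (Str): for combinational $h\colon a\to b$ and $\overline v\in\mathbf V^a$, $\mathrm{reg}(\overline v);h\rightsquigarrow\big((\overline v;h)\otimes(h;\delta_b)\big);\mathrm{join}_b$. Value rules: $v;\mathrm{fork}\rightsquigarrow v\otimes v$; $(v\otimes w);\mathrm{join}\rightsquigarrow v\sqcup w$; $v;\mathrm{elim}\rightsquigarrow\mathrm{id}_0$; $\overline v;p\rightsquigarrow[\![p]\!](\overline v)$. Productivity: for every sequential $f\colon m\to n$ and $\overline v\in\mathbf V^m$, applying (Mealy), (IF), (Str) once successively and then the value rules exhaustively gives $\mathrm{reg}(\overline v);f\rightsquigarrow^*f';\mathrm{reg}(\overline w)$ for some $\overline w\in\mathbf V^n$ and circuit $f'$. Applied successively to an input waveform $\overline v_0,\dots,\overline v_{k-1}\in\mathbf V^m$ (so $f_0=f$ and $\mathrm{reg}(\overline v_i);f_i\rightsquigarrow^*f_{i+1};\mathrm{reg}(\overline w_i)$), it produces an output waveform $\overline w_0,\dots,\overline w_{k-1}\in\mathbf V^n$. Observational equivalence. Two sequential circuits $f,g\colon m\to n$ with no more than $c$ delay generators are observationally equivalent under $\mathcal I$, written $f\sim_{\mathcal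 I}g$, if applying productivity produces the same output waveforms for all input waveforms in $(\mathbf V^m)^\star$ of length $|\mathbf V|^c+1$. A relation on parallel circuits of $\mathbf{SCirc}_\Sigma$ is adequate if it only relates circuits with the same denotation $[\![-]\!]^{\mathsf S}_{\mathcal I}$; it is a congruence if it is an equivalence relation preserved by composition, tensor and trace. Largest is with respect to inclusion.
   Formalization: Observational equivalence is taken to require equal output waveforms of length |V|^c+1 for every c bounding the delays of both circuits, so arbitrarily long waveforms are compared; with a single chosen c the relation is not adequate and the claim fails. -}

module Defs where

open import Level using (Level; 0ℓ) renaming (suc to lsuc)
open import Data.Nat using (ℕ; zero; suc; _+_; _*_; _^_; _≤_; z≤n; s≤s)
import Data.Nat as ℕ
import Data.Nat.Properties as ℕₚ
open import Data.Fin using (Fin; toℕ; combine)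
import Data.Fin as Fin
import Data.Fin.Properties as Finₚ
open import Data.List using (List; length)
open import Data.List.Relation.Unary.Linked using (Linked)
open import Data.Product using (Σ; ∃-syntax; _×_; _,_; proj₁; proj₂)
open import Data.Vec using (Vec; []; _∷_; _++_; take; drop; replicate)
import Data.Vec.Properties as Vecₚ
open import Data.Vec.Relation.Binary.Pointwise.Inductive as Pointwise using (Pointwise; []; _∷_)
open import Function.Base using (_∘_)
open import Function.Bundles using (_↔_; _⇔_; Inverse)
open import Relation.Binary.Core using (Rel)
open import Relation.Binary.Definitions using (DecidableEquality; Minimum)
open import Relation.Binary.Lattice.Structures using (IsLattice)
open import Relation.Binary.Construct.Closure.ReflexiveTransitive using (Star)
import Relation.Binary.Construct.NonStrictToStrict as NonStrictToStrict
open import Relation.Binary.PropositionalEquality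
  using (_≡_; _≢_; refl; sym; trans; cong; cong₂; subst)
open import Relation.Nullary using (yes; no)
open import Relation.Nullary.Decidable using (map′)

record Signature : Set₁ where
  field
    V      : Set
    card   : ℕ
    finite : V ↔ Fin card
    •      : V
    P      : Set
    dom    : P → ℕ
    cod    : P → ℕ

  toFin : V → Fin card
  toFin = Inverse.to finite

  toFin-injective : ∀ {u v} → toFin u ≡ toFin v → u ≡ v
  toFin-injective {u} {v} eq =
    trans (sym (Inverse.strictlyInverseʳ finite u))
          (trans (cong (Inverse.from finite) eq) (Inverse.strictlyInverseʳ finite v))

  _≟_ : DecidableEquality V
  u ≟ v = map′ toFin-injective (cong toFin) (toFin u Fin.≟ toFin v)

record Interpretation (S : Signature) : Set₁ where
  open Signature S
  infix  4 _⊑_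
  infixr 6 _⊔_
  field
    _⊑_       : Rel V 0ℓ
    _⊔_ _⊓_   : V → V → V
    isLattice : IsLattice _≡_ _⊑_ _⊔_ _⊓_
    minimum   : Minimum _⊑_ •
    ⟦_⟧ₚ      : (p : P) → Vec V (dom p) → Vec V (cod p)
    monotoneₚ : ∀ p {us vs} → Pointwise _⊑_ us vs → Pointwise _⊑_ (⟦ p ⟧ₚ us) (⟦ p ⟧ₚ vs)
    ⊥-presₚ   : ∀ p → ⟦ p ⟧ₚ (replicate (dom p) •) ≡ replicate (cod p) •

------------------------------------------------------------------------
-- Circuits

module Circuits (S : Signature) where
  open Signature S

  infixl 5 _⨟_
  infixr 7 _⊗_
  infix  4 _≈_

  data CGen : ℕ → ℕ → Set where
    prim  : (p : P) → CGen (dom p) (cod p)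
    fork  : CGen 1 2
    join  : CGen 2 1
    intro : CGen 0 1
    elim  : CGen 1 0

  -- The reduction rules use a combinational circuit only through its image in
  -- the sequential circuits, so the equations of PROPs are imposed there (_≈_).
  data CCirc : ℕ → ℕ → Set where
    gen  : ∀ {m n} → CGen m n → CCirc m n
    id   : ∀ n → CCirc n n
    _⨟_  : ∀ {m n k} → CCirc m n → CCirc n k → CCirc m k
    _⊗_  : ∀ {m n k l} → CCirc m n → CCirc k l → CCirc (m + k) (n + l)
    swap : ∀ m n → CCirc (m + n) (n + m)

  data SGen : ℕ → ℕ → Set where
    comb : ∀ {m n} → CGen m n → SGen m n
    val  : (v : V) → .(v ≢ •) → SGen 0 1
    δ    : SGen 1 1

  data SCirc : ℕ → ℕ → Set where
    gen  : ∀ {m n} → SGen m n → SCirc m n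
    id   : ∀ n → SCirc n n
    _⨟_  : ∀ {m n k} → SCirc m n → SCirc n k → SCirc m k
    _⊗_  : ∀ {m n k l} → SCirc m n → SCirc k l → SCirc (m + k) (n + l)
    swap : ∀ m n → SCirc (m + n) (n + m)
    Tr   : ∀ x {m n} → SCirc (x + m) (x + n) → SCirc m n

  ⌜_⌝ : ∀ {m n} → CCirc m n → SCirc m n
  ⌜ gen g ⌝    = gen (comb g)
  ⌜ id n ⌝     = id n
  ⌜ f ⨟ g ⌝    = ⌜ f ⌝ ⨟ ⌜ g ⌝
  ⌜ f ⊗ g ⌝    = ⌜ f ⌝ ⊗ ⌜ g ⌝
  ⌜ swap m n ⌝ = swap m n

  -- Objects that are equal only propositionally, such as (m + n) + k and
  -- m + (n + k), are mediated by identities.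
  coe : ∀ {m n} → m ≡ n → SCirc m n
  coe {m} refl = id m

  coeᶜ : ∀ {m n} → m ≡ n → CCirc m n
  coeᶜ {m} refl = id m

  -- Equality of morphisms in the free symmetric traced PROP.
  data _≈_ : ∀ {m n} → SCirc m n → SCirc m n → Set where
    ≈-refl  : ∀ {m n} {f : SCirc m n} → f ≈ f
    ≈-sym   : ∀ {m n} {f g : SCirc m n} → f ≈ g → g ≈ f
    ≈-trans : ∀ {m n} {f g h : SCirc m n} → f ≈ g → g ≈ h → f ≈ h
    ⨟-cong  : ∀ {m n k} {f f′ : SCirc m n} {g g′ : SCirc n k} →
              f ≈ f′ → g ≈ g′ → f ⨟ g ≈ f′ ⨟ g′
    ⊗-cong  : ∀ {m n k l} {f f′ : SCirc m n} {g g′ : SCirc k l} →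
              f ≈ f′ → g ≈ g′ → f ⊗ g ≈ f′ ⊗ g′
    Tr-cong : ∀ {x m n} {f f′ : SCirc (x + m) (x + n)} → f ≈ f′ → Tr x f ≈ Tr x f′

    ⨟-identityˡ : ∀ {m n} {f : SCirc m n} → id m ⨟ f ≈ f
    ⨟-identityʳ : ∀ {m n} {f : SCirc m n} → f ⨟ id n ≈ f
    ⨟-assoc     : ∀ {m n k l} {f : SCirc m n} {g : SCirc n k} {h : SCirc k l} →
                  (f ⨟ g) ⨟ h ≈ f ⨟ (g ⨟ h)

    ⊗-id          : ∀ {m n} → id m ⊗ id n ≈ id (m + n)
    ⊗-interchange : ∀ {m n k m′ n′ k′} {f : SCirc m n} {g : SCirc n k}
                    {f′ : SCirc m′ n′} {g′ : SCirc n′ k′} →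
                    (f ⨟ g) ⊗ (f′ ⨟ g′) ≈ (f ⊗ f′) ⨟ (g ⊗ g′)
    ⊗-identityˡ   : ∀ {m n} {f : SCirc m n} → id 0 ⊗ f ≈ f
    ⊗-identityʳ   : ∀ {m n} {f : SCirc m n} →
                    (f ⊗ id 0) ⨟ coe (ℕₚ.+-identityʳ n) ≈ coe (ℕₚ.+-identityʳ m) ⨟ f
    ⊗-assoc       : ∀ {m₁ m₂ m₃ n₁ n₂ n₃}
                    {f : SCirc m₁ n₁} {g : SCirc m₂ n₂} {h : SCirc m₃ n₃} →
                    ((f ⊗ g) ⊗ h) ⨟ coe (ℕₚ.+-assoc n₁ n₂ n₃)
                      ≈ coe (ℕₚ.+-assoc m₁ m₂ m₃) ⨟ (f ⊗ (g ⊗ h))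

    swap-natural    : ∀ {m n k l} {f : SCirc m n} {g : SCirc k l} →
                      (f ⊗ g) ⨟ swap n l ≈ swap m k ⨟ (g ⊗ f)
    swap-involutive : ∀ {m n} → swap m n ⨟ swap n m ≈ id (m + n)
    swap-hexagon    : ∀ {m n k} →
                      coe (ℕₚ.+-assoc m n k) ⨟ swap m (n + k) ⨟ coe (ℕₚ.+-assoc n k m)
                        ≈ (swap m n ⊗ id k) ⨟ coe (ℕₚ.+-assoc n m k) ⨟ (id n ⊗ swap m k)

    Tr-tighten   : ∀ {x m n k l} {f : SCirc m n} {g : SCirc (x + n) (x + k)} {h : SCirc k l} →
                   Tr x ((id x ⊗ f) ⨟ g ⨟ (id x ⊗ h)) ≈ f ⨟ Tr x g ⨟ h
    Tr-slide     : ∀ {x y m n} {f : SCirc x y} {g : SCirc (y + m) (x + n)} →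
                   Tr x ((f ⊗ id m) ⨟ g) ≈ Tr y (g ⨟ (f ⊗ id n))
    Tr-vanish₀   : ∀ {m n} {f : SCirc m n} → Tr 0 f ≈ f
    Tr-vanish₊   : ∀ {x y m n} {f : SCirc ((x + y) + m) ((x + y) + n)} →
                   Tr (x + y) f
                     ≈ Tr y (Tr x (coe (sym (ℕₚ.+-assoc x y m)) ⨟ f ⨟ coe (ℕₚ.+-assoc x y n)))
    Tr-superpose : ∀ {x m n k l} {f : SCirc (x + m) (x + n)} {g : SCirc k l} →
                   Tr x f ⊗ g
                     ≈ Tr x (coe (sym (ℕₚ.+-assoc x m k)) ⨟ (f ⊗ g) ⨟ coe (ℕₚ.+-assoc x n l))
    Tr-yank      : ∀ {x} → Tr x (swap x x) ≈ id x

  forks : ∀ n → CCirc n (n + n)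
  forks zero    = id 0
  forks (suc n) =
    (gen fork ⊗ forks n) ⨟ (id 1 ⊗ ((swap 1 n ⊗ id n) ⨟ coeᶜ (ℕₚ.+-assoc n 1 n)))

  joins : ∀ n → CCirc (n + n) n
  joins zero    = id 0
  joins (suc n) =
    (id 1 ⊗ (coeᶜ (sym (ℕₚ.+-assoc n 1 n)) ⨟ (swap n 1 ⊗ id n))) ⨟ (gen join ⊗ joins n)

  elims : ∀ n → CCirc n 0
  elims zero    = id 0
  elims (suc n) = gen elim ⊗ elims n

  intros : ∀ n → CCirc 0 n
  intros zero    = id 0
  intros (suc n) = gen intro ⊗ intros n

  δs : ∀ n → SCirc n n
  δs zero    = id 0
  δs (suc n) = gen δ ⊗ δs n

  value : V → SCirc 0 1
  value v with v ≟ •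
  ... | yes _  = gen (comb intro)
  ... | no v≢• = gen (val v v≢•)

  values : ∀ {n} → Vec V n → SCirc 0 n
  values []       = id 0
  values (v ∷ vs) = value v ⊗ values vs

  reg : ∀ {n} → Vec V n → SCirc n n
  reg {n} vs = (values vs ⊗ δs n) ⨟ ⌜ joins n ⌝

  -- The equations of _≈_ preserve the number of delays.
  delays : ∀ {m n} → SCirc m n → ℕ
  delays (gen (comb _))  = 0
  delays (gen (val _ _)) = 0
  delays (gen δ)         = 1
  delays (id _)          = 0
  delays (f ⨟ g)         = delays f + delays g
  delays (f ⊗ g)         = delays f + delays g
  delays (swap _ _)      = 0
  delays (Tr _ f)        = delays f

  -- Relations on parallel morphisms of the free symmetric traced PROP are
  -- relations on terms that respect _≈_.
  CircuitRelation : (ℓ : Level) → Set (lsuc ℓ)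
  CircuitRelation ℓ = ∀ {m n} → Rel (SCirc m n) ℓ

  record IsCongruence {ℓ} (R : CircuitRelation ℓ) : Set ℓ where
    field
      respects-≈  : ∀ {m n} {f f′ g g′ : SCirc m n} → f ≈ f′ → g ≈ g′ → R f g → R f′ g′
      reflexive   : ∀ {m n} {f : SCirc m n} → R f f
      symmetric   : ∀ {m n} {f g : SCirc m n} → R f g → R g f
      transitive  : ∀ {m n} {f g h : SCirc m n} → R f g → R g h → R f h
      ⨟-preserved : ∀ {m n k} {f f′ : SCirc m n} {g g′ : SCirc n k} →
                    R f f′ → R g g′ → R (f ⨟ g) (f′ ⨟ g′)
      ⊗-preserved : ∀ {m n k l} {f f′ : SCirc m n} {g g′ : SCirc k l} →
                    R f f′ → R g g′ → R (f ⊗ g) (f′ ⊗ g′)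
      Tr-preserved : ∀ {x m n} {f f′ : SCirc (x + m) (x + n)} → R f f′ → R (Tr x f) (Tr x f′)

------------------------------------------------------------------------
-- Stream functions and denotation

module Denotation (S : Signature) (I : Interpretation S) where
  open Signature S
  open Interpretation I
  open Circuits S
  private module L = IsLattice isLattice

  infix 4 _⊑ᵛ_ _⊑ˢ_ _≗ˢ_
  infixr 5 _++ˢ_

  _⊑ᵛ_ : ∀ {n} → Rel (Vec V n) 0ℓ
  _⊑ᵛ_ = Pointwise _⊑_

  Stream : ℕ → Set
  Stream n = ℕ → Vec V n

  _⊑ˢ_ : ∀ {n} → Rel (Stream n) 0ℓ
  σ ⊑ˢ τ = ∀ k → σ k ⊑ᵛ τ k

  _≗ˢ_ : ∀ {n} → Rel (Stream n) 0ℓ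
  σ ≗ˢ τ = ∀ k → σ k ≡ τ k

  _++ˢ_ : ∀ {m n} → Stream m → Stream n → Stream (m + n)
  (σ ++ˢ τ) k = σ k ++ τ k

  -- The stream v ∷ σ.
  cons : ∀ {n} → Vec V n → Stream n → Stream n
  cons v σ zero    = v
  cons v σ (suc k) = σ k

  Agree : ∀ {n} → ℕ → Rel (Stream n) 0ℓ
  Agree k σ τ = ∀ i → i ≤ k → σ i ≡ τ i

  Causal : ∀ {m n} → (Stream m → Stream n) → Set
  Causal F = ∀ {σ τ} k → Agree k σ τ → F σ k ≡ F τ k

  Monotone : ∀ {m n} → (Stream m → Stream n) → Set
  Monotone F = ∀ {σ τ} → σ ⊑ˢ τ → F σ ⊑ˢ F τ

  record StreamFn (m n : ℕ) : Set where
    field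
      fun      : Stream m → Stream n
      causal   : Causal fun
      monotone : Monotone fun
  open StreamFn public

  ⊑ᵛ-refl : ∀ {n} {us : Vec V n} → us ⊑ᵛ us
  ⊑ᵛ-refl = Pointwise.refl L.refl

  ⊑ᵛ-trans : ∀ {n} {us vs ws : Vec V n} → us ⊑ᵛ vs → vs ⊑ᵛ ws → us ⊑ᵛ ws
  ⊑ᵛ-trans = Pointwise.trans L.trans

  ⊑ᵛ-antisym : ∀ {n} {us vs : Vec V n} → us ⊑ᵛ vs → vs ⊑ᵛ us → us ≡ vs
  ⊑ᵛ-antisym []       []       = refl
  ⊑ᵛ-antisym (p ∷ ps) (q ∷ qs) = cong₂ _∷_ (L.antisym p q) (⊑ᵛ-antisym ps qs)

  ⊑ᵛ-minimum : ∀ {n} (us : Vec V n) → replicate n • ⊑ᵛ us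
  ⊑ᵛ-minimum []       = []
  ⊑ᵛ-minimum (u ∷ us) = minimum u ∷ ⊑ᵛ-minimum us

  ++-mono : ∀ {m n} {us us′ : Vec V m} {vs vs′ : Vec V n} →
            us ⊑ᵛ us′ → vs ⊑ᵛ vs′ → us ++ vs ⊑ᵛ us′ ++ vs′
  ++-mono []       qs = qs
  ++-mono (p ∷ ps) qs = p ∷ ++-mono ps qs

  take-mono : ∀ m {n} {us vs : Vec V (m + n)} → us ⊑ᵛ vs → take m us ⊑ᵛ take m vs
  take-mono zero                               ps       = []
  take-mono (suc m) {us = _ ∷ _} {vs = _ ∷ _} (p ∷ ps) = p ∷ take-mono m ps

  drop-mono : ∀ m {n} {us vs : Vec V (m + n)} → us ⊑ᵛ vs → drop m us ⊑ᵛ drop m vs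
  drop-mono zero                               ps       = ps
  drop-mono (suc m) {us = _ ∷ _} {vs = _ ∷ _} (p ∷ ps) = drop-mono m ps

  ⊔-mono : ∀ {u u′ v v′} → u ⊑ u′ → v ⊑ v′ → u ⊔ v ⊑ u′ ⊔ v′
  ⊔-mono p q = L.∨-least (L.trans p (L.x≤x∨y _ _)) (L.trans q (L.y≤x∨y _ _))

  elementwise : ∀ {m n} (φ : Vec V m → Vec V n) →
                (∀ {us vs} → us ⊑ᵛ vs → φ us ⊑ᵛ φ vs) → StreamFn m n
  elementwise φ φ-mono = record
    { fun      = λ σ k → φ (σ k)
    ; causal   = λ k e → cong φ (e k ℕₚ.≤-refl)
    ; monotone = λ p k → φ-mono (p k)
    }

  valueFn : V → StreamFn 0 1
  valueFn v = record
    { fun      = λ _ → cons (v ∷ []) (λ _ → • ∷ [])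
    ; causal   = λ _ _ → refl
    ; monotone = λ _ _ → ⊑ᵛ-refl
    }

  delayFn : StreamFn 1 1
  delayFn = record { fun = cons (• ∷ []) ; causal = caus ; monotone = mono }
    where
    caus : Causal (cons (• ∷ []))
    caus zero    e = refl
    caus (suc k) e = e k (ℕₚ.n≤1+n k)
    mono : Monotone (cons (• ∷ []))
    mono p zero    = ⊑ᵛ-refl
    mono p (suc k) = p k

  seqFn : ∀ {m n k} → StreamFn m n → StreamFn n k → StreamFn m k
  seqFn F G = record
    { fun      = λ σ → fun G (fun F σ)
    ; causal   = λ k e → causal G k λ i i≤k →
                   causal F i (λ j j≤i → e j (ℕₚ.≤-trans j≤i i≤k))
    ; monotone = λ p → monotone G (monotone F p)
    }

  parFn : ∀ {m n k l} → StreamFn m n → StreamFn k l → StreamFn (m + k) (n + l)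
  parFn {m} F G = record
    { fun      = λ σ → fun F (take m ∘ σ) ++ˢ fun G (drop m ∘ σ)
    ; causal   = λ k e → cong₂ _++_ (causal F k λ i i≤k → cong (take m) (e i i≤k))
                                    (causal G k λ i i≤k → cong (drop m) (e i i≤k))
    ; monotone = λ p k → ++-mono (monotone F (take-mono m ∘ p) k)
                                 (monotone G (drop-mono m ∘ p) k)
    }

  -- For f on x + m and an input σ, the map whose least fixed point is fed back.
  feedback : ∀ {x m n} → StreamFn (x + m) (x + n) → Stream m → Stream x → Stream x
  feedback {x} f σ τ = take x ∘ fun f (τ ++ˢ σ)

  IsLeastFixedPoint : ∀ {x} → (Stream x → Stream x) → Stream x → Set
  IsLeastFixedPoint F μ = F μ ≗ˢ μ × (∀ τ → F τ ≗ˢ τ → μ ⊑ˢ τ)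

  kleene : ∀ {x} → (Stream x → Stream x) → ℕ → Stream x
  kleene {x} F zero    = λ _ → replicate x •
  kleene     F (suc j) = F (kleene F j)

  -- By causality each further tick is settled by |V|ˣ further Kleene
  -- iterations; lfp-isLeastFixedPoint shows that the outcome is the least fixed
  -- point.
  bound : ℕ → ℕ → ℕ
  bound x k = suc k * card ^ x

  lfp : ∀ {x} → (Stream x → Stream x) → Stream x
  lfp {x} F k = kleene F (bound x k) k

  private
    encode : ∀ {n} → Vec V n → Fin (card ^ n)
    encode []       = Fin.zero
    encode (v ∷ vs) = combine (toFin v) (encode vs)

    encode-injective : ∀ {n} {us vs : Vec V n} → encode us ≡ encode vs → us ≡ vs
    encode-injective {us = []}     {[]}     _  = refl
    encode-injective {us = u ∷ us} {v ∷ vs} eq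
      with p , q ← Finₚ.combine-injective (toFin u) (encode us) (toFin v) (encode vs) eq
      = cong₂ _∷_ (toFin-injective p) (encode-injective q)

    ascend : ∀ {n} (a : ℕ → Vec V n) → (∀ j → a j ⊑ᵛ a (suc j)) → ∀ {i j} → i ≤ j → a i ⊑ᵛ a j
    ascend a up {j = zero}  z≤n = ⊑ᵛ-refl
    ascend a up {i} {suc j} i≤1+j with i ℕ.≟ suc j
    ... | yes refl  = ⊑ᵛ-refl
    ... | no  i≢1+j =
      ⊑ᵛ-trans (ascend a up (ℕₚ.≤-pred (ℕₚ.≤∧≢⇒< i≤1+j i≢1+j))) (up j)

    module _ {n} (a : ℕ → Vec V n) (up : ∀ j → a j ⊑ᵛ a (suc j))
             (stays : ∀ j → a j ≡ a (suc j) → a (suc j) ≡ a (suc (suc j))) where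

      constant : ∀ i → a i ≡ a (suc i) → ∀ {j} → i ≤ j → a i ≡ a j × a j ≡ a (suc j)
      constant i e {j} i≤j with i ℕ.≟ j
      ... | yes refl = refl , e
      constant i e {zero}  z≤n   | no i≢j = refl , e
      constant i e {suc j} i≤1+j | no i≢j
        with p , q ← constant i e {j} (ℕₚ.≤-pred (ℕₚ.≤∧≢⇒< i≤1+j i≢j))
        = trans p q , stays j q

      settles : ∀ {j} → card ^ n ≤ j → a (card ^ n) ≡ a j
      settles {j} N≤j
        with i , i′ , i<i′ , eq ← Finₚ.pigeonhole (ℕₚ.n<1+n (card ^ n)) (encode ∘ a ∘ toℕ)
        = trans (sym (proj₁ (constant (toℕ i) e i≤N)))
                (proj₁ (constant (toℕ i) e (ℕₚ.≤-trans i≤N N≤j)))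
        where
        i≤N : toℕ i ≤ card ^ n
        i≤N = ℕₚ.≤-pred (Finₚ.toℕ<n i)
        e : a (toℕ i) ≡ a (suc (toℕ i))
        e = ⊑ᵛ-antisym (up (toℕ i))
              (subst (a (suc (toℕ i)) ⊑ᵛ_) (sym (encode-injective eq)) (ascend a up i<i′))

  module _ {x} {F : Stream x → Stream x} (F-causal : Causal F) (F-mono : Monotone F) where
    private
      kleene-up : ∀ j → kleene F j ⊑ˢ kleene F (suc j)
      kleene-up zero    k = ⊑ᵛ-minimum _
      kleene-up (suc j) k = F-mono (kleene-up j) k

      N = card ^ x

      bound-mono : ∀ {i k} → i ≤ k → bound x i ≤ bound x k
      bound-mono i≤k = ℕₚ.*-monoˡ-≤ N (s≤s i≤k)

      -- Tick k is settled from iteration N + b on if the earlier ticks are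
      -- settled from iteration b on.
      tick : ∀ b k → (∀ {i} → suc i ≤ k → ∀ {j} → b ≤ j → kleene F b i ≡ kleene F j i) →
             ∀ {j} → N + b ≤ j → kleene F (N + b) k ≡ kleene F j k
      tick b k earlier {j} N+b≤j =
        trans (settles a (λ l → kleene-up (l + b) k) stays {j ℕ.∸ b} N≤j∸b)
              (cong (λ l → kleene F l k) (ℕₚ.m∸n+n≡m b≤j))
        where
        a : ℕ → Vec V x
        a l = kleene F (l + b) k
        b≤j : b ≤ j
        b≤j = ℕₚ.≤-trans (ℕₚ.m≤n+m b N) N+b≤j
        N≤j∸b : N ≤ j ℕ.∸ b
        N≤j∸b = ℕₚ.m+n≤o⇒m≤o∸n N N+b≤j
        stays : ∀ l → a l ≡ a (suc l) → a (suc l) ≡ a (suc (suc l))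
        stays l e = F-causal k agree
          where
          agree : Agree k (kleene F (l + b)) (kleene F (suc l + b))
          agree i i≤k with i ℕ.≟ k
          ... | yes refl = e
          ... | no  i≢k  =
            trans (sym (earlier (ℕₚ.≤∧≢⇒< i≤k i≢k) (ℕₚ.m≤n+m b l)))
                  (earlier (ℕₚ.≤∧≢⇒< i≤k i≢k) (ℕₚ.m≤n+m b (suc l)))

      settledBelow : ∀ k {i} → suc i ≤ k →
                     ∀ {j} → k * N ≤ j → kleene F (k * N) i ≡ kleene F j i
      settledBelow (suc k) {i} i<1+k {j} 1+kN≤j with i ℕ.≟ k
      ... | yes refl = tick (k * N) k (settledBelow k) 1+kN≤j
      ... | no  i≢k  =
        trans (sym (settledBelow k i<k (ℕₚ.m≤n+m (k * N) N)))
              (settledBelow k i<k (ℕₚ.≤-trans (ℕₚ.m≤n+m (k * N) N) 1+kN≤j))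
        where
        i<k : suc i ≤ k
        i<k = ℕₚ.≤∧≢⇒< (ℕₚ.≤-pred i<1+k) i≢k

    lfp-isLeastFixedPoint : IsLeastFixedPoint F (lfp F)
    lfp-isLeastFixedPoint = fixed , least
      where
      fixed : F (lfp F) ≗ˢ lfp F
      fixed k = trans (F-causal k λ i i≤k → settledBelow (suc i) ℕₚ.≤-refl (bound-mono i≤k))
                      (sym (settledBelow (suc k) ℕₚ.≤-refl (ℕₚ.n≤1+n (bound x k))))

      below : ∀ τ → F τ ≗ˢ τ → ∀ j → kleene F j ⊑ˢ τ
      below τ e zero    k = ⊑ᵛ-minimum _
      below τ e (suc j) k = subst (F (kleene F j) k ⊑ᵛ_) (e k) (F-mono (below τ e j) k)

      least : ∀ τ → F τ ≗ˢ τ → lfp F ⊑ˢ τ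
      least τ e k = below τ e (bound x k) k

  traceFn : ∀ x {m n} → StreamFn (x + m) (x + n) → StreamFn m n
  traceFn x {m} f = record
    { fun      = λ σ → drop x ∘ fun f (μ σ ++ˢ σ)
    ; causal   = λ {σ} {τ} k e → cong (drop x) (causal f k λ i i≤k →
                   cong₂ _++_ (iter-causal (bound x i) i λ j j≤i → e j (ℕₚ.≤-trans j≤i i≤k))
                              (e i i≤k))
    ; monotone = λ p k → drop-mono x (monotone f
                   (λ i → ++-mono (iter-mono p (bound x i) i) (p i)) k)
    }
    where
    μ : Stream m → Stream x
    μ σ = lfp (feedback f σ)

    iter-causal : ∀ {σ τ} j k → Agree k σ τ →
                  kleene (feedback f σ) j k ≡ kleene (feedback f τ) j k
    iter-causal zero    k e = refl
    iter-causal (suc j) k e = cong (take x) (causal f k λ i i≤k →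
      cong₂ _++_ (iter-causal j i λ l l≤i → e l (ℕₚ.≤-trans l≤i i≤k)) (e i i≤k))

    iter-mono : ∀ {σ τ} → σ ⊑ˢ τ → ∀ j → kleene (feedback f σ) j ⊑ˢ kleene (feedback f τ) j
    iter-mono p zero    k = ⊑ᵛ-refl
    iter-mono p (suc j) k =
      take-mono x (monotone f (λ i → ++-mono (iter-mono p j i) (p i)) k)

  feedback-isLeastFixedPoint : ∀ {x m n} (f : StreamFn (x + m) (x + n)) (σ : Stream m) →
    IsLeastFixedPoint (feedback {x} {m} {n} f σ) (lfp (feedback {x} {m} {n} f σ))
  feedback-isLeastFixedPoint {x} f σ = lfp-isLeastFixedPoint
    (λ k e → cong (take x) (causal f k λ i i≤k → cong (_++ σ i) (e i i≤k)))
    (λ p k → take-mono x (monotone f (λ i → ++-mono (p i) ⊑ᵛ-refl) k))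

  ⟦_⟧ᶜ : ∀ {m n} → CGen m n → StreamFn m n
  ⟦ prim p ⟧ᶜ = elementwise ⟦ p ⟧ₚ (monotoneₚ p)
  ⟦ fork ⟧ᶜ   = elementwise (λ { (v ∷ []) → v ∷ v ∷ [] }) (λ { (p ∷ []) → p ∷ p ∷ [] })
  ⟦ join ⟧ᶜ   = elementwise (λ { (u ∷ v ∷ []) → u ⊔ v ∷ [] })
                            (λ { (p ∷ q ∷ []) → ⊔-mono p q ∷ [] })
  ⟦ intro ⟧ᶜ  = elementwise (λ _ → • ∷ []) (λ _ → ⊑ᵛ-refl)
  ⟦ elim ⟧ᶜ   = elementwise (λ _ → []) (λ _ → [])

  ⟦_⟧ : ∀ {m n} → SCirc m n → StreamFn m n
  ⟦ gen (comb g) ⟧  = ⟦ g ⟧ᶜ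
  ⟦ gen (val v _) ⟧ = valueFn v
  ⟦ gen δ ⟧         = delayFn
  ⟦ id n ⟧          = elementwise (λ us → us) (λ p → p)
  ⟦ f ⨟ g ⟧         = seqFn ⟦ f ⟧ ⟦ g ⟧
  ⟦ f ⊗ g ⟧         = parFn ⟦ f ⟧ ⟦ g ⟧
  ⟦ swap m n ⟧      = elementwise (λ us → drop m us ++ take m us)
                                  (λ p → ++-mono (drop-mono m p) (take-mono m p))
  ⟦ Tr x f ⟧        = traceFn x ⟦ f ⟧

  SameDenotation : ∀ {m n} → Rel (SCirc m n) 0ℓ
  SameDenotation f g = ∀ σ → fun ⟦ f ⟧ σ ≗ˢ fun ⟦ g ⟧ σ

  Adequate : ∀ {ℓ} → CircuitRelation ℓ → Set ℓ
  Adequate R = ∀ {m n} {f g : SCirc m n} → R f g → SameDenotation f g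

------------------------------------------------------------------------
-- Reduction and observational equivalence

module Reduction (S : Signature) (I : Interpretation S) where
  open Signature S
  open Interpretation I
  open Circuits S

  infix 4 _▷[_]_ _⟶[_]_ _∼_

  -- The length of a chain is its number of elements.
  IsChain : ∀ {x} → List (Vec V x) → Set
  IsChain = Linked (NonStrictToStrict._<_ _≡_ (Pointwise _⊑_))

  LongestChainLength : ℕ → ℕ → Set
  LongestChainLength x d =
    (∃[ us ] IsChain {x} us × length us ≡ d) × (∀ us → IsChain {x} us → length us ≤ d)

  -- iterate h k is hᵏ.
  iterate : ∀ {x a b} → CCirc (x + a) (x + b) → ℕ → CCirc a (x + b)
  iterate {x} {a} h zero        = (intros x ⊗ id a) ⨟ h
  iterate {x} {a} {b} h (suc k) =
    forks a ⨟ ((iterate {x} {a} {b} h k ⨟ (id x ⊗ elims b) ⨟ coeᶜ (ℕₚ.+-identityʳ x)) ⊗ id a) ⨟ h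

  data Rule : Set where
    Mealy IF Str Value : Rule

  data _▷[_]_ : ∀ {m n} → SCirc m n → Rule → SCirc m n → Set where
    mealy : ∀ x y z {m n} (f̂ : CCirc ((x + y) + (z + m)) ((x + y) + n)) (vs : Vec V z) →
      Tr (x + y) (((id x ⊗ δs y) ⊗ (values vs ⊗ id m)) ⨟ ⌜ f̂ ⌝)
        ▷[ Mealy ]
      Tr ((x + y) + z)
        ( coe (cong (_+ m) (ℕₚ.+-assoc x y z))
        ⨟ ((id x ⊗ reg (replicate y • ++ vs)) ⊗ id m)
        ⨟ coe (trans (cong (_+ m) (sym (ℕₚ.+-assoc x y z))) (ℕₚ.+-assoc (x + y) z m))
        ⨟ ⌜ f̂ ⌝
        ⨟ (id (x + y) ⊗ (⌜ intros z ⌝ ⊗ id n))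
        ⨟ coe (sym (ℕₚ.+-assoc (x + y) z n)))
    if : ∀ x {a b} (h : CCirc (x + a) (x + b)) d → LongestChainLength x d →
      Tr x ⌜ h ⌝ ▷[ IF ] ⌜ iterate {x} {a} {b} h (suc d) ⌝ ⨟ (⌜ elims x ⌝ ⊗ id b)
    str : ∀ {a b} (h : CCirc a b) (vs : Vec V a) →
      reg vs ⨟ ⌜ h ⌝ ▷[ Str ] ((values vs ⨟ ⌜ h ⌝) ⊗ (⌜ h ⌝ ⨟ δs b)) ⨟ ⌜ joins b ⌝
    v-fork : ∀ v → value v ⨟ gen (comb fork) ▷[ Value ] value v ⊗ value v
    v-join : ∀ v w → (value v ⊗ value w) ⨟ gen (comb join) ▷[ Value ] value (v ⊔ w)
    v-elim : ∀ v → value v ⨟ gen (comb elim) ▷[ Value ] id 0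
    v-prim : ∀ p vs → values vs ⨟ gen (comb (prim p)) ▷[ Value ] values (⟦ p ⟧ₚ vs)

  data _⟶[_]_ : ∀ {m n} → SCirc m n → Rule → SCirc m n → Set where
    rule : ∀ {m n r} {f g : SCirc m n} → f ▷[ r ] g → f ⟶[ r ] g
    mod  : ∀ {m n r} {f f′ g g′ : SCirc m n} → f ≈ f′ → f′ ⟶[ r ] g′ → g′ ≈ g → f ⟶[ r ] g
    ⨟ˡ   : ∀ {m n k r} {f f′ : SCirc m n} {g : SCirc n k} → f ⟶[ r ] f′ → f ⨟ g ⟶[ r ] f′ ⨟ g
    ⨟ʳ   : ∀ {m n k r} {f : SCirc m n} {g g′ : SCirc n k} → g ⟶[ r ] g′ → f ⨟ g ⟶[ r ] f ⨟ g′
    ⊗ˡ   : ∀ {m n k l r} {f f′ : SCirc m n} {g : SCirc k l} →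
           f ⟶[ r ] f′ → f ⊗ g ⟶[ r ] f′ ⊗ g
    ⊗ʳ   : ∀ {m n k l r} {f : SCirc m n} {g g′ : SCirc k l} →
           g ⟶[ r ] g′ → f ⊗ g ⟶[ r ] f ⊗ g′
    tr   : ∀ {x m n r} {f f′ : SCirc (x + m) (x + n)} → f ⟶[ r ] f′ → Tr x f ⟶[ r ] Tr x f′

  -- One round of productivity: reg v ⨟ f reduces to f′ ⨟ reg w. Value rules are
  -- applied until a circuit of this shape is reached; the shape determines w.
  Productive : ∀ {m n} → SCirc m n → Vec V m → SCirc m n → Vec V n → Set
  Productive {m} {n} f v f′ w =
    Σ (SCirc m n) λ f₁ → Σ (SCirc m n) λ f₂ → Σ (SCirc m n) λ f₃ →
      (reg v ⨟ f) ⟶[ Mealy ] f₁ × f₁ ⟶[ IF ] f₂ × f₂ ⟶[ Str ] f₃ ×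
      Star (_⟶[ Value ]_) f₃ (f′ ⨟ reg w)

  data Produces {m n} : ∀ {k} → SCirc m n → Vec (Vec V m) k → Vec (Vec V n) k → Set where
    []  : ∀ {f} → Produces f [] []
    _∷_ : ∀ {k f f′ v w} {vs : Vec (Vec V m) k} {ws : Vec (Vec V n) k} →
          Productive f v f′ w → Produces f′ vs ws → Produces f (v ∷ vs) (w ∷ ws)

  -- The bound c on the number of delays is arbitrary, so circuits are related
  -- when they pass the test for every c that bounds both of them.
  _∼_ : CircuitRelation 0ℓ
  _∼_ {m} {n} f g =
    ∀ c → delays f ≤ c → delays g ≤ c →
    (vs : Vec (Vec V m) (card ^ c + 1)) (ws : Vec (Vec V n) (card ^ c + 1)) →
    Produces f vs ws ⇔ Produces g vs ws

{-# OPTIONS --safe #-}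
module Submission where

open import Level using (Level)
open import Data.Empty using (⊥-elim; ⊥-elim-irr)
open import Data.Fin using (Fin; zero; suc; toℕ; fromℕ<; funToFin; finToFun)
import Data.Fin.Properties as Finₚ
open import Data.List as List using (List; []; _∷_; length; applyUpTo)
import Data.List.Properties as Listₚ
open import Data.List.Membership.Propositional.Properties using (∈-lookup)
open import Data.List.Relation.Unary.All as All using ([]; _∷_)
open import Data.List.Relation.Unary.AllPairs as AllPairs using (AllPairs; []; _∷_)
open import Data.List.Relation.Unary.Linked using ([]; linked?)
open import Data.List.Relation.Unary.Linked.Properties using (Linked⇒AllPairs; applyUpTo⁺₁)
open import Data.Nat using (ℕ; zero; suc; _+_; _^_; _≤_; _<_; z≤n; s≤s)
import Data.Nat.Properties as ℕₚ
open import Data.Product using (∃-syntax; _×_; _,_; proj₁; proj₂)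
open import Data.Sum using (_⊎_; inj₁; inj₂)
open import Data.Vec using (Vec; []; _∷_; _++_; take; drop; replicate; lookup; tabulate; toList; fromList)
import Data.Vec.Properties as Vecₚ
import Data.Vec.Relation.Binary.Pointwise.Inductive as Pointwise
open import Function.Base using (_∘_)
open import Function.Bundles using (Inverse; mk⇔; Equivalence)
open import Relation.Binary.Construct.Closure.ReflexiveTransitive using (Star; ε; _◅_)
import Relation.Binary.Construct.NonStrictToStrict as NonStrictToStrict
open import Relation.Binary.Definitions using (Decidable)
open import Relation.Binary.Lattice.Structures using (IsLattice)
open import Relation.Binary.PropositionalEquality
  using (_≡_; _≢_; refl; sym; trans; cong; cong₂; subst; isEquivalence)
open import Relation.Binary.Structures using (IsPartialOrder)
open import Relation.Nullary using (Dec; yes; no)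
open import Relation.Nullary.Decidable using (map′)
import Relation.Unary as U
open import Defs

-- Observational equivalence coincides with equality of denotations, which is
-- evidently the largest adequate congruence.
--
-- Every reduction preserves the denotation, and reg v denotes σ ↦ v ∷ σ, so a
-- round of productivity from f with input v and output w forces
-- ⟦f⟧(v ∷ σ) = w ∷ ⟦f′⟧(σ): the output waveforms are the initial segments of the
-- denotation. Conversely a round always exists. By the trace axioms every
-- circuit is a trace Tr (D ⊗ id ⨟ h) of a layer D of wires, delays and values
-- around a combinational h; sorting D gives the global trace-delay form, and
-- after (Mealy), (IF) and (Str) the value rules evaluate h on the state. As
-- observational equivalence tests every bound c on the delays, it compares the
-- denotations at all times.

-- `Productive` is a relation: neither the reduct nor the order of value steps is fixed, and no
-- confluence is proved. That outputs are nevertheless determined is a semantic fact, read off at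
-- tick 0 from soundness; the successor circuits of two rounds may differ as terms and are compared
-- only by denotation. Two obstacles shape the work. Sums of objects agree only propositionally, so
-- the PROP laws come wrapped in coercions, which a heterogeneous equality absorbs. And the trace is
-- defined by a bounded Kleene iteration that is awkward to calculate with; it is replaced by an
-- order-theoretic characterisation among pre-fixed points, under which sliding becomes the rolling
-- rule for least fixed points. Existence of a round also needs the constant of (IF) as actual data,
-- hence a decidable search for a longest chain. A one-element `V` stands apart: its test waveforms
-- have length 2 whatever the bound, but all its streams coincide.

-- Calculus of the free traced PROP up to coercions.

module PROP (S : Signature) where
  open Signature S
  open Circuits S

  infix  1 begin_
  infixr 2 _≋⟨_⟩_ _≋⟨_⟨_ _≈⟨_⟩_ _≈⟨_⟨_
  infix  3 _∎
  infix  4 _≋_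

  -- Equality of circuits whose objects agree only propositionally: it makes
  -- the monoidal structure strict.
  data _≋_ {m n} (f : SCirc m n) : ∀ {m′ n′} → SCirc m′ n′ → Set where
    ≈⇒≋ : {g : SCirc m n} → f ≈ g → f ≋ g

  ≋⇒≈ : ∀ {m n} {f g : SCirc m n} → f ≋ g → f ≈ g
  ≋⇒≈ (≈⇒≋ p) = p

  ≋-refl : ∀ {m n} {f : SCirc m n} → f ≋ f
  ≋-refl = ≈⇒≋ ≈-refl

  ≋-sym : ∀ {m n m′ n′} {f : SCirc m n} {g : SCirc m′ n′} → f ≋ g → g ≋ f
  ≋-sym (≈⇒≋ p) = ≈⇒≋ (≈-sym p)

  ≋-trans : ∀ {m n m′ n′ m″ n″} {f : SCirc m n} {g : SCirc m′ n′} {h : SCirc m″ n″} →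
            f ≋ g → g ≋ h → f ≋ h
  ≋-trans (≈⇒≋ p) (≈⇒≋ q) = ≈⇒≋ (≈-trans p q)

  begin_ : ∀ {m n m′ n′} {f : SCirc m n} {g : SCirc m′ n′} → f ≋ g → f ≋ g
  begin p = p

  _≋⟨_⟩_ : ∀ {m n m′ n′ m″ n″} (f : SCirc m n) {g : SCirc m′ n′} {h : SCirc m″ n″} →
           f ≋ g → g ≋ h → f ≋ h
  f ≋⟨ p ⟩ q = ≋-trans p q

  _≋⟨_⟨_ : ∀ {m n m′ n′ m″ n″} (f : SCirc m n) {g : SCirc m′ n′} {h : SCirc m″ n″} →
           g ≋ f → g ≋ h → f ≋ h
  f ≋⟨ p ⟨ q = ≋-trans (≋-sym p) q

  _≈⟨_⟩_ : ∀ {m n m′ n′} (f : SCirc m n) {g : SCirc m n} {h : SCirc m′ n′} →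
           f ≈ g → g ≋ h → f ≋ h
  f ≈⟨ p ⟩ q = ≋-trans (≈⇒≋ p) q

  _≈⟨_⟨_ : ∀ {m n m′ n′} (f : SCirc m n) {g : SCirc m n} {h : SCirc m′ n′} →
           g ≈ f → g ≋ h → f ≋ h
  f ≈⟨ p ⟨ q = ≋-trans (≈⇒≋ (≈-sym p)) q

  _∎ : ∀ {m n} (f : SCirc m n) → f ≋ f
  f ∎ = ≋-refl

  ⨟-cong≋ : ∀ {m n k m′ n′ k′} {f : SCirc m n} {g : SCirc n k} {f′ : SCirc m′ n′}
            {g′ : SCirc n′ k′} → f ≋ f′ → g ≋ g′ → f ⨟ g ≋ f′ ⨟ g′
  ⨟-cong≋ (≈⇒≋ p) (≈⇒≋ q) = ≈⇒≋ (⨟-cong p q)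

  ⊗-cong≋ : ∀ {m n k l m′ n′ k′ l′} {f : SCirc m n} {g : SCirc k l} {f′ : SCirc m′ n′}
            {g′ : SCirc k′ l′} → f ≋ f′ → g ≋ g′ → f ⊗ g ≋ f′ ⊗ g′
  ⊗-cong≋ (≈⇒≋ p) (≈⇒≋ q) = ≈⇒≋ (⊗-cong p q)

  -- The summands are equated separately because an equation between sums does not determine them.
  Tr-cong≋ : ∀ {x m n x′ m′ n′} {f : SCirc (x + m) (x + n)} {f′ : SCirc (x′ + m′) (x′ + n′)} →
             x ≡ x′ → m ≡ m′ → n ≡ n′ → f ≋ f′ → Tr x {m} {n} f ≋ Tr x′ {m′} {n′} f′
  Tr-cong≋ refl refl refl (≈⇒≋ p) = ≈⇒≋ (Tr-cong p)

  coeʳ : ∀ {m n n′} {f : SCirc m n} (p : n ≡ n′) → f ⨟ coe p ≋ f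
  coeʳ refl = ≈⇒≋ ⨟-identityʳ

  coeˡ : ∀ {m m′ n} {f : SCirc m n} (p : m′ ≡ m) → coe p ⨟ f ≋ f
  coeˡ refl = ≈⇒≋ ⨟-identityˡ

  coe-≋ : ∀ {m n} (p : m ≡ n) → coe p ≋ id m
  coe-≋ refl = ≋-refl

  id-≋ : ∀ {m n} → m ≡ n → id m ≋ id n
  id-≋ refl = ≋-refl

  coeᶜʳ : ∀ {m n n′} {f : SCirc m n} (p : n ≡ n′) → f ⨟ ⌜ coeᶜ p ⌝ ≋ f
  coeᶜʳ refl = ≈⇒≋ ⨟-identityʳ

  coeᶜˡ : ∀ {m m′ n} {f : SCirc m n} (p : m′ ≡ m) → ⌜ coeᶜ p ⌝ ⨟ f ≋ f
  coeᶜˡ refl = ≈⇒≋ ⨟-identityˡ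

  coeᶜ² : ∀ {m m′ n n′} {f : SCirc m n} (p : m′ ≡ m) (q : n ≡ n′) →
         ⌜ coeᶜ p ⌝ ⨟ f ⨟ ⌜ coeᶜ q ⌝ ≋ f
  coeᶜ² p q = ≋-trans (coeᶜʳ q) (coeᶜˡ p)

  coe² : ∀ {m m′ n n′} {f : SCirc m n} (p : m′ ≡ m) (q : n ≡ n′) → coe p ⨟ f ⨟ coe q ≋ f
  coe² p q = ≋-trans (coeʳ q) (coeˡ p)

  ⨟-congˡ : ∀ {m n k} {f f′ : SCirc m n} {g : SCirc n k} → f ≈ f′ → f ⨟ g ≈ f′ ⨟ g
  ⨟-congˡ p = ⨟-cong p ≈-refl

  ⨟-congʳ : ∀ {m n k} {f : SCirc m n} {g g′ : SCirc n k} → g ≈ g′ → f ⨟ g ≈ f ⨟ g′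
  ⨟-congʳ p = ⨟-cong ≈-refl p

  -- The left side has the shape of the body produced by (Mealy). The middle coercion is kept in
  -- combinational form so that everything after `f` can be the image of one combinational circuit.
  uncast : ∀ {a a′ b b′ c d d′} {f : SCirc a b} {g : SCirc b′ c} {h : SCirc c d}
           (p : a′ ≡ a) (q : b ≡ b′) (r : d ≡ d′) →
           coe p ⨟ f ⨟ coe q ⨟ g ⨟ h ⨟ coe r ≋ f ⨟ (⌜ coeᶜ q ⌝ ⨟ g ⨟ h)
  uncast refl refl refl = ≈⇒≋ (≈-trans ⨟-identityʳ
    (≈-trans (⨟-congˡ (≈-trans (⨟-congˡ (≈-trans ⨟-identityʳ ⨟-identityˡ))
      (⨟-congʳ (≈-sym ⨟-identityˡ)))) ⨟-assoc))

  ⊗-assoc≋ : ∀ {m₁ m₂ m₃ n₁ n₂ n₃} {f : SCirc m₁ n₁} {g : SCirc m₂ n₂} {h : SCirc m₃ n₃} →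
             (f ⊗ g) ⊗ h ≋ f ⊗ (g ⊗ h)
  ⊗-assoc≋ {m₁} {m₂} {m₃} {n₁} {n₂} {n₃} =
    ≋-trans (≋-sym (coeʳ (ℕₚ.+-assoc n₁ n₂ n₃)))
            (≋-trans (≈⇒≋ ⊗-assoc) (coeˡ (ℕₚ.+-assoc m₁ m₂ m₃)))

  ⊗-identityʳ≋ : ∀ {m n} {f : SCirc m n} → f ⊗ id 0 ≋ f
  ⊗-identityʳ≋ {m} {n} =
    ≋-trans (≋-sym (coeʳ (ℕₚ.+-identityʳ n)))
            (≋-trans (≈⇒≋ ⊗-identityʳ) (coeˡ (ℕₚ.+-identityʳ m)))

  ⊗-⨟ : ∀ {m n k m′ n′ k′} {f : SCirc m n} {g : SCirc n k} {f′ : SCirc m′ n′} {g′ : SCirc n′ k′} →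
        (f ⊗ f′) ⨟ (g ⊗ g′) ≈ (f ⨟ g) ⊗ (f′ ⨟ g′)
  ⊗-⨟ = ≈-sym ⊗-interchange

  ⊗-splitˡ : ∀ {m n k l} {f : SCirc m n} {g : SCirc k l} → (f ⊗ id k) ⨟ (id n ⊗ g) ≈ f ⊗ g
  ⊗-splitˡ = ≈-trans ⊗-⨟ (⊗-cong ⨟-identityʳ ⨟-identityˡ)

  ⊗-splitʳ : ∀ {m n k l} {f : SCirc m n} {g : SCirc k l} → (id m ⊗ g) ⨟ (f ⊗ id l) ≈ f ⊗ g
  ⊗-splitʳ = ≈-trans ⊗-⨟ (⊗-cong ⨟-identityˡ ⨟-identityʳ)

  ⊗id-⨟ : ∀ {m n k l} {f : SCirc m n} {g : SCirc n k} → (f ⨟ g) ⊗ id l ≈ (f ⊗ id l) ⨟ (g ⊗ id l)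
  ⊗id-⨟ = ≈-trans (⊗-cong ≈-refl (≈-sym ⨟-identityˡ)) ⊗-interchange

  id⊗-⨟ : ∀ {m n k l} {f : SCirc m n} {g : SCirc n k} → id l ⊗ (f ⨟ g) ≈ (id l ⊗ f) ⨟ (id l ⊗ g)
  id⊗-⨟ = ≈-trans (⊗-cong (≈-sym ⨟-identityˡ) ≈-refl) ⊗-interchange

  swap-conj : ∀ {m n k} {g : SCirc m n} → swap k m ⨟ (g ⊗ id k) ⨟ swap n k ≈ id k ⊗ g
  swap-conj {m} {n} {k} {g} = ≋⇒≈ (begin
    swap k m ⨟ (g ⊗ id k) ⨟ swap n k ≈⟨ ⨟-congˡ (≈-sym swap-natural) ⟩
    (id k ⊗ g) ⨟ swap k n ⨟ swap n k ≈⟨ ⨟-assoc ⟩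
    (id k ⊗ g) ⨟ (swap k n ⨟ swap n k) ≈⟨ ⨟-congʳ swap-involutive ⟩
    (id k ⊗ g) ⨟ id (k + n) ≈⟨ ⨟-identityʳ ⟩
    id k ⊗ g ∎)

  -- By the hexagon law, swap m 0 is an invertible idempotent.
  swap-0ʳ : ∀ m → swap m 0 ≋ id m
  swap-0ʳ m = begin
    swap m 0        ≋⟨ t≋s ⟨
    t               ≈⟨ ⨟-identityʳ ⟨
    t ⨟ id m        ≈⟨ ⨟-congʳ inverse ⟨
    t ⨟ (t ⨟ t⁻¹)   ≈⟨ ⨟-assoc ⟨
    t ⨟ t ⨟ t⁻¹     ≈⟨ ⨟-congˡ (≋⇒≈ idempotent) ⟩
    t ⨟ t⁻¹         ≈⟨ inverse ⟩
    id m            ∎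
    where
    t t⁻¹ : SCirc m m
    t   = coe (sym (ℕₚ.+-identityʳ m)) ⨟ swap m 0
    t⁻¹ = swap 0 m ⨟ coe (ℕₚ.+-identityʳ m)
    t≋s : t ≋ swap m 0
    t≋s = coeˡ _
    inverse : t ⨟ t⁻¹ ≈ id m
    inverse = ≋⇒≈ (begin
      t ⨟ t⁻¹              ≋⟨ ⨟-cong≋ t≋s (coeʳ _) ⟩
      swap m 0 ⨟ swap 0 m  ≈⟨ swap-involutive ⟩
      id (m + 0)           ≋⟨ id-≋ (ℕₚ.+-identityʳ m) ⟩
      id m                 ∎)
    idempotent : t ⨟ t ≋ t
    idempotent = begin
      t ⨟ t  ≈⟨ ⨟-cong (≈-sym ⨟-identityʳ) (≈-sym ⊗-identityˡ) ⟩
      t ⨟ id m ⨟ (id 0 ⊗ t)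
        ≋⟨ ⨟-cong≋ (⨟-cong≋ (≋-trans t≋s (≋-sym ⊗-identityʳ≋)) (id-≋ (sym (ℕₚ.+-identityʳ m))))
                   (⊗-cong≋ (≋-refl {f = id 0}) t≋s) ⟩
      (swap m 0 ⊗ id 0) ⨟ coe (ℕₚ.+-assoc 0 m 0) ⨟ (id 0 ⊗ swap m 0) ≈⟨ swap-hexagon ⟨
      coe (ℕₚ.+-assoc m 0 0) ⨟ swap m 0 ⨟ id m ≋⟨ ≋-trans (coe² _ refl) (≋-sym t≋s) ⟩
      t ∎

  swap-0ˡ : ∀ m → swap 0 m ≋ id m
  swap-0ˡ m = begin
    swap 0 m                           ≋⟨ coeʳ (ℕₚ.+-identityʳ m) ⟨
    swap 0 m ⨟ coe (ℕₚ.+-identityʳ m)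
      ≋⟨ ⨟-cong≋ ≋-refl (≋-trans (≋-trans (coe-≋ _) (id-≋ (ℕₚ.+-identityʳ m))) (≋-sym (swap-0ʳ m))) ⟩
    swap 0 m ⨟ swap m 0                ≈⟨ swap-involutive ⟩
    id m                               ∎

  -- Middle-four interchange

  mid : ∀ a b c d → CCirc ((a + b) + (c + d)) ((a + c) + (b + d))
  mid a b c d =
    coeᶜ (ℕₚ.+-assoc a b (c + d)) ⨟
    (id a ⊗ (coeᶜ (sym (ℕₚ.+-assoc b c d)) ⨟ (swap b c ⊗ id d) ⨟ coeᶜ (ℕₚ.+-assoc c b d))) ⨟
    coeᶜ (sym (ℕₚ.+-assoc a c (b + d)))

  mid-≋ : ∀ a b c d → ⌜ mid a b c d ⌝ ≋ id a ⊗ (swap b c ⊗ id d)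
  mid-≋ a b c d = ≋-trans (coeᶜ² _ _) (⊗-cong≋ ≋-refl (coeᶜ² _ _))

  regroup : ∀ {a b c d a′ b′ c′ d′} {A : SCirc a a′} {B : SCirc b b′} {C : SCirc c c′}
            {D : SCirc d d′} → (A ⊗ B) ⊗ (C ⊗ D) ≋ A ⊗ ((B ⊗ C) ⊗ D)
  regroup = ≋-trans ⊗-assoc≋ (⊗-cong≋ ≋-refl (≋-sym ⊗-assoc≋))

  mid-natural : ∀ {a b c d a′ b′ c′ d′} {A : SCirc a a′} {B : SCirc b b′} {C : SCirc c c′}
                {D : SCirc d d′} →
                ((A ⊗ B) ⊗ (C ⊗ D)) ⨟ ⌜ mid a′ b′ c′ d′ ⌝ ≈ ⌜ mid a b c d ⌝ ⨟ ((A ⊗ C) ⊗ (B ⊗ D))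
  mid-natural {a} {b} {c} {d} {a′} {b′} {c′} {d′} {A} {B} {C} {D} = ≋⇒≈ (begin
    ((A ⊗ B) ⊗ (C ⊗ D)) ⨟ ⌜ mid a′ b′ c′ d′ ⌝
      ≋⟨ ⨟-cong≋ regroup (mid-≋ a′ b′ c′ d′) ⟩
    (A ⊗ ((B ⊗ C) ⊗ D)) ⨟ (id a′ ⊗ (swap b′ c′ ⊗ id d′))
      ≈⟨ ≈-trans ⊗-⨟ (⊗-cong (≈-trans ⨟-identityʳ (≈-sym ⨟-identityˡ))
           (≈-trans ⊗-⨟ (≈-trans (⊗-cong swap-natural (≈-trans ⨟-identityʳ (≈-sym ⨟-identityˡ)))
              ⊗-interchange))) ⟩
    (id a ⨟ A) ⊗ ((swap b c ⊗ id d) ⨟ ((C ⊗ B) ⊗ D)) ≈⟨ ⊗-interchange ⟩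
    (id a ⊗ (swap b c ⊗ id d)) ⨟ (A ⊗ ((C ⊗ B) ⊗ D))
      ≋⟨ ⨟-cong≋ (≋-sym (mid-≋ a b c d)) (≋-sym regroup) ⟩
    ⌜ mid a b c d ⌝ ⨟ ((A ⊗ C) ⊗ (B ⊗ D)) ∎)

  mid-involutive : ∀ a b c d → ⌜ mid a b c d ⌝ ⨟ ⌜ mid a c b d ⌝ ≈ id ((a + b) + (c + d))
  mid-involutive a b c d = ≋⇒≈ (begin
    ⌜ mid a b c d ⌝ ⨟ ⌜ mid a c b d ⌝ ≋⟨ ⨟-cong≋ (mid-≋ a b c d) (mid-≋ a c b d) ⟩
    (id a ⊗ (swap b c ⊗ id d)) ⨟ (id a ⊗ (swap c b ⊗ id d))
      ≈⟨ ≈-trans (≈-sym id⊗-⨟) (⊗-cong ≈-refl (≈-trans (≈-sym ⊗id-⨟) (⊗-cong swap-involutive ≈-refl))) ⟩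
    id a ⊗ (id (b + c) ⊗ id d)
      ≋⟨ ≋-trans (⊗-cong≋ ≋-refl (⊗-cong≋ (≋-sym (≈⇒≋ ⊗-id)) ≋-refl)) (≋-sym regroup) ⟩
    (id a ⊗ id b) ⊗ (id c ⊗ id d) ≈⟨ ≈-trans (⊗-cong ⊗-id ⊗-id) ⊗-id ⟩
    id ((a + b) + (c + d)) ∎)

  -- Rearranges a tensor of two composite blocks by kind; this is what merges two sorted layers.
  mid-conj : ∀ {a b c d a′ b′ c′ d′} {A : SCirc a a′} {B : SCirc b b′} {C : SCirc c c′}
             {D : SCirc d d′} →
             (A ⊗ B) ⊗ (C ⊗ D) ≈
             ⌜ mid a b c d ⌝ ⨟ ((A ⊗ C) ⊗ (B ⊗ D)) ⨟ ⌜ mid a′ c′ b′ d′ ⌝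
  mid-conj {a′ = a′} {b′} {c′} {d′} =
    ≈-trans (≈-sym ⨟-identityʳ)
      (≈-trans (⨟-congʳ (≈-sym (mid-involutive a′ b′ c′ d′)))
        (≈-trans (≈-sym ⨟-assoc) (⨟-congˡ mid-natural)))

  joins-suc : ∀ n → ⌜ joins (suc n) ⌝ ≈ ⌜ mid 1 n 1 n ⌝ ⨟ (gen (comb join) ⊗ ⌜ joins n ⌝)
  joins-suc n = ⨟-congˡ (≋⇒≈ (≋-trans (⊗-cong≋ ≋-refl (coeᶜˡ _)) (≋-sym (mid-≋ 1 n 1 n))))

  reg₁ : V → SCirc 1 1
  reg₁ v = (value v ⊗ gen δ) ⨟ gen (comb join)

  -- `joins` interleaves its two bundles by a middle-four interchange, and naturality carries that
  -- interchange past values and delays, where it meets no input on the value side and disappears.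
  -- Registers thereby become wirewise and open to induction.
  reg-∷ : ∀ {n} v (vs : Vec V n) → reg (v ∷ vs) ≈ reg₁ v ⊗ reg vs
  reg-∷ {n} v vs = ≋⇒≈ (begin
    ((value v ⊗ values vs) ⊗ (gen δ ⊗ δs n)) ⨟ ⌜ joins (suc n) ⌝
      ≈⟨ ≈-trans (⨟-congʳ (joins-suc n)) (≈-trans (≈-sym ⨟-assoc) (⨟-congˡ mid-natural)) ⟩
    ⌜ mid 0 0 1 n ⌝ ⨟ ((value v ⊗ gen δ) ⊗ (values vs ⊗ δs n)) ⨟ (gen (comb join) ⊗ ⌜ joins n ⌝)
      ≈⟨ ⨟-congˡ (≈-trans (⨟-congˡ (≋⇒≈ mid-id)) ⨟-identityˡ) ⟩
    ((value v ⊗ gen δ) ⊗ (values vs ⊗ δs n)) ⨟ (gen (comb join) ⊗ ⌜ joins n ⌝) ≈⟨ ⊗-⨟ ⟩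
    reg₁ v ⊗ reg vs ∎)
    where
    mid-id : ⌜ mid 0 0 1 n ⌝ ≋ id (1 + n)
    mid-id = begin
      ⌜ mid 0 0 1 n ⌝ ≋⟨ mid-≋ 0 0 1 n ⟩
      id 0 ⊗ (swap 0 1 ⊗ id n) ≈⟨ ⊗-identityˡ ⟩
      swap 0 1 ⊗ id n ≋⟨ ⊗-cong≋ (swap-0ˡ 1) ≋-refl ⟩
      id 1 ⊗ id n ≈⟨ ⊗-id ⟩
      id (1 + n) ∎

  -- With a single wire in front both bracketings have definitionally equal objects, so no coercion
  -- appears.
  ⊗-assoc₁ : ∀ {m n k l} {f : SCirc 1 1} {g : SCirc m n} {h : SCirc k l} →
             (f ⊗ g) ⊗ h ≈ f ⊗ (g ⊗ h)
  ⊗-assoc₁ = ≋⇒≈ ⊗-assoc≋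

  reg-++ : ∀ {m n} (us : Vec V m) (vs : Vec V n) → reg (us ++ vs) ≈ reg us ⊗ reg vs
  reg-++ [] vs = ≈-trans (≈-sym ⊗-identityˡ)
    (⊗-cong (≈-sym (≈-trans ⨟-identityʳ ⊗-identityˡ)) ≈-refl)
  reg-++ (u ∷ us) vs = ≈-trans (reg-∷ u (us ++ vs))
    (≈-trans (⊗-cong ≈-refl (reg-++ us vs))
      (≈-trans (≈-sym ⊗-assoc₁) (⊗-cong (≈-sym (reg-∷ u us)) ≈-refl)))

  values-++ : ∀ {m n} (us : Vec V m) (vs : Vec V n) → values (us ++ vs) ≈ values us ⊗ values vs
  values-++ []       vs = ≈-sym ⊗-identityˡ
  values-++ (u ∷ us) vs =
    ≈-trans (⊗-cong ≈-refl (values-++ us vs)) (≋⇒≈ (≋-sym ⊗-assoc≋))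

  δs-++ : ∀ m n → δs (m + n) ≈ δs m ⊗ δs n
  δs-++ zero    n = ≈-sym ⊗-identityˡ
  δs-++ (suc m) n = ≈-trans (⊗-cong ≈-refl (δs-++ m n)) (≈-sym ⊗-assoc₁)

-- Normal form: one trace around a layer and a combinational core.

module NormalForm (S : Signature) where
  open Signature S using (V; •; _≟_)
  open Circuits S
  open PROP S

  data Layer : ∀ {m n} → SCirc m n → Set where
    wires : ∀ n → Layer (id n)
    delay : Layer (gen δ)
    const : ∀ {v} .(v≢• : v ≢ •) → Layer (gen (val v v≢•))
    _⊗_   : ∀ {m n k l} {D : SCirc m n} {E : SCirc k l} → Layer D → Layer E → Layer (D ⊗ E)

  -- `X` and `Y` differ by the number of constants in the layer, since a value has an output wire
  -- but no input wire.
  record Traced {m n} (f : SCirc m n) : Set where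
    constructor traced
    field
      {X Y}  : ℕ
      {D}    : SCirc X Y
      layer  : Layer D
      core   : CCirc (Y + m) (X + n)
      equal  : f ≈ Tr X ((D ⊗ id m) ⨟ ⌜ core ⌝)

  Traced-resp : ∀ {m n} {f g : SCirc m n} → f ≈ g → Traced g → Traced f
  Traced-resp p (traced L h e) = traced L h (≈-trans p e)

  Tr-tightenˡ : ∀ {x m n k} {f : SCirc m n} {g : SCirc (x + n) (x + k)} →
                Tr x ((id x ⊗ f) ⨟ g) ≈ f ⨟ Tr x g
  Tr-tightenˡ {x} {k = k} =
    ≈-trans (Tr-cong (≈-sym (≈-trans (⨟-congʳ ⊗-id) ⨟-identityʳ)))
            (≈-trans (Tr-tighten {h = id k}) ⨟-identityʳ)

  Tr-tightenʳ : ∀ {x m n k} {g : SCirc (x + m) (x + n)} {h : SCirc n k} →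
                Tr x (g ⨟ (id x ⊗ h)) ≈ Tr x g ⨟ h
  Tr-tightenʳ {x} {m} =
    ≈-trans (Tr-cong (⨟-congˡ (≈-sym (≈-trans (⨟-congˡ ⊗-id) ⨟-identityˡ))))
            (≈-trans (Tr-tighten {f = id m}) (⨟-congˡ ⨟-identityˡ))

  Tr-nested : ∀ {x y m n} {f : SCirc (x + (y + m)) (x + (y + n))}
              {g : SCirc ((x + y) + m) ((x + y) + n)} → f ≋ g → Tr y (Tr x f) ≈ Tr (x + y) g
  Tr-nested {x} {y} {m} {n} p =
    ≈-sym (≈-trans Tr-vanish₊ (Tr-cong (Tr-cong (≋⇒≈ (≋-trans (coe² _ _) (≋-sym p))))))

  Traced-pre : ∀ {m n k} (a : CCirc m n) {f : SCirc n k} → Traced f → Traced (⌜ a ⌝ ⨟ f)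
  Traced-pre {m} {n} a {f} (traced {X} {Y} {D} L h e) =
    traced L ((id Y ⊗ a) ⨟ h) (≋⇒≈ (begin
      ⌜ a ⌝ ⨟ f ≈⟨ ≈-trans (⨟-congʳ e) (≈-sym Tr-tightenˡ) ⟩
      Tr X ((id X ⊗ ⌜ a ⌝) ⨟ ((D ⊗ id n) ⨟ ⌜ h ⌝))
        ≈⟨ Tr-cong (≈-trans (≈-sym ⨟-assoc)
             (≈-trans (⨟-congˡ (≈-trans ⊗-splitʳ (≈-sym ⊗-splitˡ))) ⨟-assoc)) ⟩
      Tr X ((D ⊗ id m) ⨟ ((id Y ⊗ ⌜ a ⌝) ⨟ ⌜ h ⌝)) ∎))

  Traced-post : ∀ {m n k} {f : SCirc m n} (b : CCirc n k) → Traced f → Traced (f ⨟ ⌜ b ⌝)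
  Traced-post b (traced {X} L h e) =
    traced L (h ⨟ (id X ⊗ b))
      (≈-trans (⨟-congˡ e) (≈-trans (≈-sym Tr-tightenʳ) (Tr-cong ⨟-assoc)))

  Traced-⊗id : ∀ {m n} k {f : SCirc m n} → Traced f → Traced (f ⊗ id k)
  Traced-⊗id {m} {n} k {f} (traced {X} {Y} {D} L h e) =
    traced L h′ (≈-trans (⊗-cong e ≈-refl) (≈-trans Tr-superpose (Tr-cong (≋⇒≈ (begin
      coe (sym (ℕₚ.+-assoc X m k)) ⨟ (((D ⊗ id m) ⨟ ⌜ h ⌝) ⊗ id k) ⨟ coe (ℕₚ.+-assoc X n k)
        ≋⟨ coe² _ _ ⟩
      ((D ⊗ id m) ⨟ ⌜ h ⌝) ⊗ id k ≈⟨ ⊗id-⨟ ⟩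
      ((D ⊗ id m) ⊗ id k) ⨟ (⌜ h ⌝ ⊗ id k)
        ≋⟨ ⨟-cong≋ (≋-trans ⊗-assoc≋ (⊗-cong≋ ≋-refl (≈⇒≋ ⊗-id))) (≋-sym (coeᶜ² _ _)) ⟩
      (D ⊗ id (m + k)) ⨟ ⌜ h′ ⌝ ∎)))))
    where
    h′ : CCirc (Y + (m + k)) (X + (n + k))
    h′ = coeᶜ (sym (ℕₚ.+-assoc Y m k)) ⨟ (h ⊗ id k) ⨟ coeᶜ (ℕₚ.+-assoc X n k)

  -- Superposition adds wires only on the right of a loop; conjugating with the symmetry moves them
  -- to the left.
  Traced-id⊗ : ∀ {m n} k {f : SCirc m n} → Traced f → Traced (id k ⊗ f)
  Traced-id⊗ {m} {n} k t =
    Traced-resp (≈-sym swap-conj) (Traced-post (swap n k) (Traced-pre (swap k m) (Traced-⊗id k t)))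

  -- By tightening, `E` enters the loop of `f`, and vanishing merges the two loops, so the layers
  -- combine by tensor. Trace is the case where `E` consists of wires; composition places the first
  -- circuit beside the layer of the second.
  Traced-Tr : ∀ {z w m n} {E : SCirc z w} {f : SCirc (w + m) (z + n)} → Layer E →
              Traced f → Traced (Tr z ((E ⊗ id m) ⨟ f))
  Traced-Tr {z} {w} {m} {n} {E} {f} M (traced {X} {Y} {D} L h e) =
    traced (L ⊗ M) h′ (≋⇒≈ (begin
      Tr z ((E ⊗ id m) ⨟ f) ≈⟨ Tr-cong (≈-trans (⨟-congʳ e) (≈-sym Tr-tightenˡ)) ⟩
      Tr z (Tr X ((id X ⊗ (E ⊗ id m)) ⨟ ((D ⊗ id (w + m)) ⨟ ⌜ h ⌝)))
        ≈⟨ Tr-nested (begin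
             (id X ⊗ (E ⊗ id m)) ⨟ ((D ⊗ id (w + m)) ⨟ ⌜ h ⌝)
               ≈⟨ ≈-trans (≈-sym ⨟-assoc) (⨟-congˡ ⊗-splitʳ) ⟩
             (D ⊗ (E ⊗ id m)) ⨟ ⌜ h ⌝ ≋⟨ ⨟-cong≋ (≋-sym ⊗-assoc≋) (≋-sym (coeᶜ² _ _)) ⟩
             ((D ⊗ E) ⊗ id m) ⨟ ⌜ h′ ⌝ ∎) ⟩
      Tr (X + z) (((D ⊗ E) ⊗ id m) ⨟ ⌜ h′ ⌝) ∎))
    where
    h′ : CCirc ((Y + w) + m) ((X + z) + n)
    h′ = coeᶜ (ℕₚ.+-assoc Y w m) ⨟ h ⨟ coeᶜ (sym (ℕₚ.+-assoc X z n))

  Traced-⨟ : ∀ {m n k} {f : SCirc m n} {g : SCirc n k} → Traced f → Traced g → Traced (f ⨟ g)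
  Traced-⨟ {m} {n} {f = f} {g} t (traced {Z} {W} {E} M h e) =
    Traced-resp (≋⇒≈ (begin
      f ⨟ g ≈⟨ ≈-trans (⨟-congʳ e) (≈-sym Tr-tightenˡ) ⟩
      Tr Z ((id Z ⊗ f) ⨟ ((E ⊗ id n) ⨟ ⌜ h ⌝))
        ≈⟨ Tr-cong (≈-trans (≈-sym ⨟-assoc)
             (≈-trans (⨟-congˡ (≈-trans ⊗-splitʳ (≈-sym ⊗-splitˡ))) ⨟-assoc)) ⟩
      Tr Z ((E ⊗ id m) ⨟ ((id W ⊗ f) ⨟ ⌜ h ⌝)) ∎))
      (Traced-Tr M (Traced-post h (Traced-id⊗ W t)))

  Traced-comb : ∀ {m n} (h : CCirc m n) → Traced ⌜ h ⌝
  Traced-comb h = traced (wires 0) h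
    (≈-sym (≈-trans Tr-vanish₀ (≈-trans (⨟-congˡ ⊗-id) ⨟-identityˡ)))

  Traced-normal : ∀ {m n} (f : SCirc m n) → Traced f
  Traced-normal (gen (comb g)) = Traced-comb (gen g)
  Traced-normal (gen (val v v≢•)) = traced (const v≢•) (id 1)
    (≈-sym (≈-trans Tr-vanish₀ (≈-trans ⨟-identityʳ (≋⇒≈ ⊗-identityʳ≋))))
  -- A delay put on the feedback wire of a crossing moves to the output by naturality, and the bare
  -- crossing yanks straight.
  Traced-normal (gen δ) = traced delay (swap 1 1)
    (≈-sym (≈-trans (Tr-cong swap-natural) (≈-trans Tr-tightenʳ (≈-trans (⨟-congˡ Tr-yank) ⨟-identityˡ))))
  Traced-normal (id n) = Traced-comb (id n)
  Traced-normal (f ⨟ g) = Traced-⨟ (Traced-normal f) (Traced-normal g)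
  Traced-normal (_⊗_ {k = k} f g) = Traced-resp (≈-sym ⊗-splitˡ)
    (Traced-⨟ (Traced-⊗id k (Traced-normal f)) (Traced-id⊗ _ (Traced-normal g)))
  Traced-normal (swap m n) = Traced-comb (swap m n)
  Traced-normal (Tr x f) = Traced-resp (Tr-cong (≈-sym (≈-trans (⨟-congˡ ⊗-id) ⨟-identityˡ)))
    (Traced-Tr (wires x) (Traced-normal f))

  sorted : ∀ x y {z} → Vec V z → SCirc ((x + y) + 0) ((x + y) + z)
  sorted x y vs = (id x ⊗ δs y) ⊗ values vs

  record Sorted {m n} (D : SCirc m n) : Set where
    constructor mkSorted
    field
      x y {z} : ℕ
      vs      : Vec V z
      pre     : CCirc m ((x + y) + 0)
      post    : CCirc ((x + y) + z) n
      equal   : D ≈ ⌜ pre ⌝ ⨟ sorted x y vs ⨟ ⌜ post ⌝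

  sort-≋ : ∀ {m n} {D : SCirc m n} x y {z} (vs : Vec V z) → m ≡ (x + y) + 0 → (x + y) + z ≡ n →
           sorted x y vs ≋ D → Sorted D
  sort-≋ x y vs p q e = mkSorted x y vs (coeᶜ p) (coeᶜ q)
    (≋⇒≈ (≋-sym (≋-trans (coeᶜ² p q) e)))

  -- `val` takes its proof irrelevantly, so the refutation found by the decision and the given one
  -- yield the same generator.
  value-≢ : ∀ {v} .(v≢• : v ≢ •) → value v ≡ gen (val v v≢•)
  value-≢ {v} v≢• with v ≟ •
  ... | yes v≡• = ⊥-elim-irr (v≢• v≡•)
  ... | no _    = refl

  -- A tensor of sorted layers needs two middle-four interchanges: an outer one separating values
  -- from wires and delays, and an inner one separating wires from delays. The rewirings are
  -- collected in `pre` and `post`.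
  sort : ∀ {m n} {D : SCirc m n} → Layer D → Sorted D
  sort (wires n) = sort-≋ n 0 [] (sym (trans (ℕₚ.+-identityʳ (n + 0)) (ℕₚ.+-identityʳ n)))
                          (trans (ℕₚ.+-identityʳ (n + 0)) (ℕₚ.+-identityʳ n))
                          (≋-trans ⊗-identityʳ≋ ⊗-identityʳ≋)
  sort delay = sort-≋ 0 1 [] refl refl
    (≋-trans ⊗-identityʳ≋ (≋-trans (≈⇒≋ ⊗-identityˡ) ⊗-identityʳ≋))
  sort (const {v} v≢•) = sort-≋ 0 0 (v ∷ []) refl refl
    (≋-trans (≈⇒≋ (≈-trans (⊗-cong ⊗-identityˡ ≈-refl) ⊗-identityˡ))
       (≋-trans ⊗-identityʳ≋ (≡⇒≋ (value-≢ v≢•))))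
    where
    ≡⇒≋ : ∀ {m n} {f g : SCirc m n} → f ≡ g → f ≋ g
    ≡⇒≋ refl = ≋-refl
  sort (_⊗_ {D = D} {E} L M) with sort L | sort M
  ... | mkSorted x₁ y₁ {z₁} us a₁ b₁ e₁ | mkSorted x₂ y₂ {z₂} vs a₂ b₂ e₂ =
    mkSorted (x₁ + x₂) (y₁ + y₂) (us ++ vs)
      ((a₁ ⊗ a₂) ⨟ (mid (x₁ + y₁) 0 (x₂ + y₂) 0 ⨟ (mid x₁ y₁ x₂ y₂ ⊗ id 0)))
      ((mid x₁ x₂ y₁ y₂ ⊗ id (z₁ + z₂)) ⨟ mid (x₁ + y₁) (x₂ + y₂) z₁ z₂ ⨟ (b₁ ⊗ b₂))
      (≋⇒≈ (begin
        D ⊗ E ≈⟨ ⊗-cong e₁ e₂ ⟩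
        (⌜ a₁ ⌝ ⨟ S₁ ⨟ ⌜ b₁ ⌝) ⊗ (⌜ a₂ ⌝ ⨟ S₂ ⨟ ⌜ b₂ ⌝)
          ≈⟨ ≈-trans ⊗-interchange (⨟-congˡ ⊗-interchange) ⟩
        A ⨟ (S₁ ⊗ S₂) ⨟ B ≈⟨ ⨟-congˡ (⨟-congʳ merged) ⟩
        A ⨟ ((P ⨟ sorted (x₁ + x₂) (y₁ + y₂) (us ++ vs)) ⨟ Q) ⨟ B
          ≈⟨ ≈-trans (⨟-congˡ (≈-trans (≈-sym ⨟-assoc) (⨟-congˡ (≈-sym ⨟-assoc)))) ⨟-assoc ⟩
        A ⨟ P ⨟ sorted (x₁ + x₂) (y₁ + y₂) (us ++ vs) ⨟ (Q ⨟ B) ∎))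
    where
    S₁ = sorted x₁ y₁ us
    S₂ = sorted x₂ y₂ vs
    A = ⌜ a₁ ⌝ ⊗ ⌜ a₂ ⌝
    B = ⌜ b₁ ⌝ ⊗ ⌜ b₂ ⌝
    P₁ = ⌜ mid (x₁ + y₁) 0 (x₂ + y₂) 0 ⌝
    P₂ = ⌜ mid x₁ y₁ x₂ y₂ ⌝ ⊗ id 0
    P = P₁ ⨟ P₂
    Q₁ = ⌜ mid x₁ x₂ y₁ y₂ ⌝ ⊗ id (z₁ + z₂)
    Q₂ = ⌜ mid (x₁ + y₁) (x₂ + y₂) z₁ z₂ ⌝
    Q = Q₁ ⨟ Q₂
    registers : (id x₁ ⊗ δs y₁) ⊗ (id x₂ ⊗ δs y₂) ≈
                ⌜ mid x₁ y₁ x₂ y₂ ⌝ ⨟ (id (x₁ + x₂) ⊗ δs (y₁ + y₂)) ⨟ ⌜ mid x₁ x₂ y₁ y₂ ⌝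
    registers = ≈-trans mid-conj (⨟-congˡ (⨟-congʳ (⊗-cong ⊗-id (≈-sym (δs-++ y₁ y₂)))))
    merged : S₁ ⊗ S₂ ≈ (P ⨟ sorted (x₁ + x₂) (y₁ + y₂) (us ++ vs)) ⨟ Q
    merged = ≋⇒≈ (begin
      S₁ ⊗ S₂ ≈⟨ mid-conj ⟩
      P₁ ⨟ (((id x₁ ⊗ δs y₁) ⊗ (id x₂ ⊗ δs y₂)) ⊗ (values us ⊗ values vs)) ⨟ Q₂
        ≈⟨ ⨟-congˡ (⨟-congʳ (⊗-cong registers (≈-sym (≈-trans (⨟-congˡ ⨟-identityˡ)
              (≈-trans ⨟-identityʳ (values-++ us vs)))))) ⟩
      P₁ ⨟ ((_ ⨟ _ ⨟ _) ⊗ (id 0 ⨟ values (us ++ vs) ⨟ id (z₁ + z₂))) ⨟ Q₂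
        ≈⟨ ⨟-congˡ (⨟-congʳ (≈-trans ⊗-interchange (⨟-congˡ ⊗-interchange))) ⟩
      P₁ ⨟ (P₂ ⨟ sorted (x₁ + x₂) (y₁ + y₂) (us ++ vs) ⨟ Q₁) ⨟ Q₂
        ≈⟨ ≈-trans (⨟-congˡ (≈-trans (≈-sym ⨟-assoc) (⨟-congˡ (≈-sym ⨟-assoc)))) ⨟-assoc ⟩
      (P ⨟ sorted (x₁ + x₂) (y₁ + y₂) (us ++ vs)) ⨟ Q ∎)

-- Existence of a round of productivity.

module Productivity (S : Signature) (I : Interpretation S) where
  open Signature S using (V; •; _≟_)
  open Interpretation I
  open Circuits S
  open Reduction S I
  open PROP S
  open NormalForm S

  evalᵍ : ∀ {m n} → CGen m n → Vec V m → Vec V n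
  evalᵍ (prim p) us           = ⟦ p ⟧ₚ us
  evalᵍ fork     (u ∷ [])     = u ∷ u ∷ []
  evalᵍ join     (u ∷ v ∷ []) = (u ⊔ v) ∷ []
  evalᵍ intro    _            = • ∷ []
  evalᵍ elim     _            = []

  -- The meeting point of syntax and semantics: the value rules compute it (`values-eval`), and
  -- combinational circuits denote its tickwise application (`eval-denotes`).
  eval : ∀ {m n} → CCirc m n → Vec V m → Vec V n
  eval (gen g)             us = evalᵍ g us
  eval (id n)              us = us
  eval (f ⨟ g)             us = eval g (eval f us)
  eval (_⊗_ {m = m} f g)   us = eval f (take m us) ++ eval g (drop m us)
  eval (swap m n)          us = drop m us ++ take m us

  infix 4 _⇝_
  infixr 5 _◂_

  -- Value rewriting in which a reduction of length zero may still pass to an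
  -- equal circuit.
  data _⇝_ {m n} (f : SCirc m n) : SCirc m n → Set where
    done : ∀ {g} → f ≈ g → f ⇝ g
    _◂_  : ∀ {g h} → f ⟶[ Value ] g → g ⇝ h → f ⇝ h

  ≈-⇝ : ∀ {m n} {f g h : SCirc m n} → f ≈ g → g ⇝ h → f ⇝ h
  ≈-⇝ p (done q) = done (≈-trans p q)
  ≈-⇝ p (r ◂ q)  = mod p r ≈-refl ◂ q

  ⇝-trans : ∀ {m n} {f g h : SCirc m n} → f ⇝ g → g ⇝ h → f ⇝ h
  ⇝-trans (done p) q = ≈-⇝ p q
  ⇝-trans (r ◂ p)  q = r ◂ ⇝-trans p q

  ⇝-≈ : ∀ {m n} {f g h : SCirc m n} → f ⇝ g → g ≈ h → f ⇝ h
  ⇝-≈ p q = ⇝-trans p (done q)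

  ⇝-map : ∀ {m n m′ n′} (C : SCirc m n → SCirc m′ n′) →
          (∀ {f g} → f ≈ g → C f ≈ C g) →
          (∀ {f g} → f ⟶[ Value ] g → C f ⟶[ Value ] C g) →
          ∀ {f g} → f ⇝ g → C f ⇝ C g
  ⇝-map C c r (done p) = done (c p)
  ⇝-map C c r (p ◂ q)  = r p ◂ ⇝-map C c r q

  ⇝-⨟ˡ : ∀ {m n k} {f f′ : SCirc m n} {g : SCirc n k} → f ⇝ f′ → f ⨟ g ⇝ f′ ⨟ g
  ⇝-⨟ˡ {g = g} = ⇝-map (_⨟ g) ⨟-congˡ ⨟ˡ

  ⇝-⊗ˡ : ∀ {m n k l} {f f′ : SCirc m n} {g : SCirc k l} → f ⇝ f′ → f ⊗ g ⇝ f′ ⊗ g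
  ⇝-⊗ˡ {g = g} = ⇝-map (_⊗ g) (λ p → ⊗-cong p ≈-refl) ⊗ˡ

  ⇝-⊗ʳ : ∀ {m n k l} {f : SCirc m n} {g g′ : SCirc k l} → g ⇝ g′ → f ⊗ g ⇝ f ⊗ g′
  ⇝-⊗ʳ {f = f} = ⇝-map (f ⊗_) (⊗-cong ≈-refl) ⊗ʳ

  -- A possibly empty `Star` cannot absorb an equality of circuits, but the step before it can,
  -- since every `⟶[ r ]` is closed under `mod`. In a round that step is (Str).
  ⟶⇝-star : ∀ {m n r} {f g h : SCirc m n} → f ⟶[ r ] g → g ⇝ h →
            ∃[ g′ ] f ⟶[ r ] g′ × Star (_⟶[ Value ]_) g′ h
  ⟶⇝-star p (done q) = _ , mod ≈-refl p q , ε
  ⟶⇝-star p (q ◂ s) with _ , q′ , s′ ← ⟶⇝-star q s = _ , p , q′ ◅ s′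

  value-• : value • ≡ gen (comb intro)
  value-• with • ≟ •
  ... | yes _  = refl
  ... | no •≢• = ⊥-elim (•≢• refl)

  ≡⇒≈ : ∀ {m n} {f g : SCirc m n} → f ≡ g → f ≈ g
  ≡⇒≈ refl = ≈-refl

  values₁ : ∀ {v} → values (v ∷ []) ≈ value v
  values₁ = ≋⇒≈ ⊗-identityʳ≋

  values-gen : ∀ {m n} (g : CGen m n) (us : Vec V m) →
               values us ⨟ gen (comb g) ⇝ values (evalᵍ g us)
  values-gen (prim p) us           = rule (v-prim p us) ◂ done ≈-refl
  values-gen fork     (u ∷ [])     =
    ≈-⇝ (⨟-congˡ values₁) (rule (v-fork u) ◂ done (⊗-cong ≈-refl (≈-sym values₁)))
  values-gen join     (u ∷ v ∷ []) =
    ≈-⇝ (⨟-congˡ (⊗-cong ≈-refl values₁)) (rule (v-join u v) ◂ done (≈-sym values₁))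
  -- The introduction is already the value `•`, so this case is an equality rather than a reduction.
  values-gen intro    []           = done (≈-trans ⨟-identityˡ (≈-sym (≈-trans values₁ (≡⇒≈ value-•))))
  values-gen elim     (u ∷ [])     =
    ≈-⇝ (⨟-congˡ values₁) (rule (v-elim u) ◂ done ≈-refl)

  values-take-drop : ∀ m {n} (us : Vec V (m + n)) →
                     values us ≈ values (take m us) ⊗ values (drop m us)
  values-take-drop m us =
    ≈-trans (≡⇒≈ (cong values (sym (Vecₚ.take++drop≡id m us)))) (values-++ (take m us) (drop m us))

  values-eval : ∀ {m n} (h : CCirc m n) (us : Vec V m) → values us ⨟ ⌜ h ⌝ ⇝ values (eval h us)
  values-eval (gen g) us = values-gen g us
  values-eval (id n)  us = done ⨟-identityʳ
  values-eval (f ⨟ g) us =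
    ≈-⇝ (≈-sym ⨟-assoc) (⇝-trans (⇝-⨟ˡ (values-eval f us)) (values-eval g (eval f us)))
  values-eval (_⊗_ {m = m} f g) us =
    ≈-⇝ (≈-trans (⨟-congˡ (values-take-drop m us)) ⊗-⨟)
      (⇝-trans (⇝-⊗ˡ (values-eval f (take m us)))
        (⇝-≈ (⇝-⊗ʳ (values-eval g (drop m us)))
             (≈-sym (values-++ (eval f (take m us)) (eval g (drop m us))))))
  values-eval (swap m n) us =
    done (≈-trans (⨟-congˡ (values-take-drop m us))
      (≈-trans swap-natural (≈-trans (⨟-congˡ (≋⇒≈ (swap-0ʳ 0)))
        (≈-trans ⨟-identityˡ (≈-sym (values-++ (drop m us) (take m us)))))))

  record GlobalForm {m n} (f : SCirc m n) : Set where
    field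
      x y {z} : ℕ
      vs      : Vec V z
      core    : CCirc ((x + y) + (z + m)) ((x + y) + n)
      equal   : f ≈ Tr (x + y) (((id x ⊗ δs y) ⊗ (values vs ⊗ id m)) ⨟ ⌜ core ⌝)

  -- Of the rewirings left over from sorting, `b` joins the core directly, while `a` stands before
  -- the layer and slides round the loop to the end of the core.
  globalForm : ∀ {m n} (f : SCirc m n) → GlobalForm f
  globalForm {m} {n} f with Traced-normal f
  ... | traced {X} {Y} {D} L h e with sort L
  ... | mkSorted x y {z} vs a b eD = record { x = x ; y = y ; vs = vs ; core = f̂ ; equal = ≋⇒≈ (begin
      f ≈⟨ e ⟩
      Tr X ((D ⊗ id m) ⨟ ⌜ h ⌝)
        ≈⟨ Tr-cong (≈-trans (⨟-congˡ (≈-trans (⊗-cong eD ≈-refl) (≈-trans ⊗id-⨟ (⨟-congˡ ⊗id-⨟))))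
             (≈-trans ⨟-assoc ⨟-assoc)) ⟩
      Tr X ((⌜ a ⌝ ⊗ id m) ⨟ ((sorted x y vs ⊗ id m) ⨟ ((⌜ b ⌝ ⊗ id m) ⨟ ⌜ h ⌝)))
        ≈⟨ ≈-trans Tr-slide (Tr-cong ⨟-assoc) ⟩
      Tr ((x + y) + 0) ((sorted x y vs ⊗ id m) ⨟ ((⌜ b ⌝ ⊗ id m) ⨟ ⌜ h ⌝ ⨟ (⌜ a ⌝ ⊗ id n)))
        ≋⟨ Tr-cong≋ (ℕₚ.+-identityʳ (x + y)) refl refl (⨟-cong≋ ⊗-assoc≋ (≋-sym (coeᶜ² _ _))) ⟩
      Tr (x + y) (((id x ⊗ δs y) ⊗ (values vs ⊗ id m)) ⨟ ⌜ f̂ ⌝) ∎) }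
    where
    f̂ : CCirc ((x + y) + (z + m)) ((x + y) + n)
    f̂ = coeᶜ (sym (ℕₚ.+-assoc (x + y) z m)) ⨟ ((b ⊗ id m) ⨟ h ⨟ (a ⊗ id n)) ⨟
        coeᶜ (cong (_+ n) (ℕₚ.+-identityʳ (x + y)))

  -- The two loops are nested on purpose: the outer carries state, the inner instantaneous feedback.
  -- Thus (IF) applies to `Tr x ⌜ core ⌝`, after which (Str) meets a single register holding the
  -- state together with the current input.
  record AfterMealy {m n} (f : SCirc m n) (v : Vec V m) : Set where
    field
      x {s}  : ℕ
      state  : Vec V s
      core   : CCirc (x + (s + m)) (x + (s + n))
      mealy⟶ : (reg v ⨟ f) ⟶[ Mealy ] Tr s (reg (state ++ v) ⨟ Tr x ⌜ core ⌝)

  afterMealy : ∀ {m n} (f : SCirc m n) (v : Vec V m) → AfterMealy f v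
  afterMealy {m} {n} f v = record
    { x = x ; state = u ; core = g″
    ; mealy⟶ = mod (⨟-congʳ equal) (⨟ʳ (rule (mealy x y z core vs))) (≋⇒≈ (begin
        reg v ⨟ Tr ((x + y) + z) _
          ≋⟨ ⨟-cong≋ ≋-refl (Tr-cong≋ (ℕₚ.+-assoc x y z) refl refl simplify) ⟩
        reg v ⨟ Tr (x + s) (((id x ⊗ reg u) ⊗ id m) ⨟ ⌜ g′ ⌝) ≈⟨ Tr-tightenˡ ⟨
        Tr (x + s) ((id (x + s) ⊗ reg v) ⨟ (((id x ⊗ reg u) ⊗ id m) ⨟ ⌜ g′ ⌝))
          ≈⟨ Tr-nested (begin
               (id x ⊗ (reg u ⊗ reg v)) ⨟ ⌜ g″ ⌝ ≋⟨ ⨟-cong≋ (≋-sym ⊗-assoc≋) (coeᶜ² _ _) ⟩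
               ((id x ⊗ reg u) ⊗ reg v) ⨟ ⌜ g′ ⌝
                 ≈⟨ ≈-trans (⨟-congˡ (≈-sym ⊗-splitʳ)) ⨟-assoc ⟩
               (id (x + s) ⊗ reg v) ⨟ (((id x ⊗ reg u) ⊗ id m) ⨟ ⌜ g′ ⌝) ∎) ⟨
        Tr s (Tr x ((id x ⊗ (reg u ⊗ reg v)) ⨟ ⌜ g″ ⌝))
          ≈⟨ Tr-cong (≈-trans Tr-tightenˡ (⨟-congˡ (≈-sym (reg-++ u v)))) ⟩
        Tr s (reg (u ++ v) ⨟ Tr x ⌜ g″ ⌝) ∎)) }
    where
    open GlobalForm (globalForm f)
    s = y + z
    u = replicate y • ++ vs
    coe₁ : (x + s) + m ≡ (x + y) + (z + m)
    coe₁ = trans (cong (_+ m) (sym (ℕₚ.+-assoc x y z))) (ℕₚ.+-assoc (x + y) z m)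
    coe₂ : (x + y) + (z + n) ≡ (x + s) + n
    coe₂ = trans (sym (ℕₚ.+-assoc (x + y) z n)) (cong (_+ n) (ℕₚ.+-assoc x y z))
    g′ : CCirc ((x + s) + m) ((x + s) + n)
    g′ = coeᶜ coe₁ ⨟ core ⨟ (id (x + y) ⊗ (intros z ⊗ id n)) ⨟ coeᶜ coe₂
    g″ : CCirc (x + (s + m)) (x + (s + n))
    g″ = coeᶜ (sym (ℕₚ.+-assoc x s m)) ⨟ g′ ⨟ coeᶜ (ℕₚ.+-assoc x s n)
    simplify :
      coe (cong (_+ m) (ℕₚ.+-assoc x y z)) ⨟ ((id x ⊗ reg u) ⊗ id m) ⨟ coe coe₁ ⨟ ⌜ core ⌝ ⨟
      (id (x + y) ⊗ (⌜ intros z ⌝ ⊗ id n)) ⨟ coe (sym (ℕₚ.+-assoc (x + y) z n))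
        ≋ ((id x ⊗ reg u) ⊗ id m) ⨟ ⌜ g′ ⌝
    simplify = ≋-trans (uncast _ coe₁ _) (⨟-cong≋ ≋-refl (≋-sym (coeᶜʳ coe₂)))

  -- Reads the right-hand side of (Str), once its value part is evaluated, as a register placed
  -- after the circuit.
  reg-pull : ∀ {m n} (f : SCirc m n) (ws : Vec V n) →
             (values ws ⊗ (f ⨟ δs n)) ⨟ ⌜ joins n ⌝ ≈ f ⨟ reg ws
  reg-pull f ws =
    ≈-trans (⨟-congˡ (≈-trans (⊗-cong (≈-sym ⨟-identityˡ) ≈-refl)
      (≈-trans ⊗-interchange (⨟-congˡ ⊗-identityˡ)))) ⨟-assoc

  productive : (∀ x → ∃[ d ] LongestChainLength x d) →
               ∀ {m n} (f : SCirc m n) (v : Vec V m) → ∃[ f′ ] ∃[ w ] Productive f v f′ w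
  productive longest {m} {n} f v
    = f′ , output , _ , _ , _ , mealy⟶ , tr (⨟ʳ (rule (if x core d (proj₂ (longest x))))) ,
      proj₂ (⟶⇝-star (tr (rule (str k (state ++ v)))) evaluated)
    where
    open AfterMealy (afterMealy f v)
    d : ℕ
    d = proj₁ (longest x)
    -- The result of (IF) is definitionally `⌜ k ⌝`, the image of a combinational circuit, as (Str)
    -- demands.
    k : CCirc (s + m) (s + n)
    k = iterate {x} {s + m} {s + n} core (suc d) ⨟ (elims x ⊗ id (s + n))
    next : Vec V (s + n)
    next = eval k (state ++ v)
    output : Vec V n
    output = drop s next
    -- The first `s` entries of `next` are the new state and stay in a register inside the loop; the
    -- others leave the trace by tightening as the output register.
    f′ : SCirc m n
    f′ = Tr s (⌜ k ⌝ ⨟ (reg (take s next) ⊗ id n))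
    evaluated : Tr s (((values (state ++ v) ⨟ ⌜ k ⌝) ⊗ (⌜ k ⌝ ⨟ δs (s + n))) ⨟ ⌜ joins (s + n) ⌝)
                ⇝ f′ ⨟ reg output
    evaluated = ⇝-≈ (⇝-map (Tr s) Tr-cong tr (⇝-⨟ˡ (⇝-⊗ˡ (values-eval k (state ++ v))))) (≋⇒≈ (begin
      Tr s ((values next ⊗ (⌜ k ⌝ ⨟ δs (s + n))) ⨟ ⌜ joins (s + n) ⌝)
        ≈⟨ Tr-cong (≈-trans (reg-pull ⌜ k ⌝ next) (⨟-congʳ (≈-trans reg-split (≈-sym ⊗-splitˡ)))) ⟩
      Tr s (⌜ k ⌝ ⨟ ((reg (take s next) ⊗ id n) ⨟ (id s ⊗ reg output)))
        ≈⟨ ≈-trans (Tr-cong (≈-sym ⨟-assoc)) Tr-tightenʳ ⟩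
      f′ ⨟ reg output ∎))
      where
      reg-split : reg next ≈ reg (take s next) ⊗ reg output
      reg-split = ≈-trans (≡⇒≈ (cong reg (sym (Vecₚ.take++drop≡id s next))))
                          (reg-++ (take s next) output)

-- Stream functions satisfy the laws of symmetric traced PROPs.

[]-unique : ∀ {A : Set} (us : Vec A 0) → us ≡ []
[]-unique [] = refl

take-++ : ∀ {A : Set} {m n} (us : Vec A m) (vs : Vec A n) → take m (us ++ vs) ≡ us
take-++ []       vs = refl
take-++ (u ∷ us) vs = cong (u ∷_) (take-++ us vs)

drop-++ : ∀ {A : Set} {m n} (us : Vec A m) (vs : Vec A n) → drop m (us ++ vs) ≡ vs
drop-++ []       vs = refl
drop-++ (u ∷ us) vs = drop-++ us vs

subst-∷ : ∀ {A : Set} {m n} (p : m ≡ n) {u : A} {us : Vec A m} →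
          subst (Vec A) (cong suc p) (u ∷ us) ≡ u ∷ subst (Vec A) p us
subst-∷ refl = refl

++-assoc-subst : ∀ {A : Set} {m n k} (us : Vec A m) (vs : Vec A n) (ws : Vec A k) →
                 subst (Vec A) (ℕₚ.+-assoc m n k) ((us ++ vs) ++ ws) ≡ us ++ (vs ++ ws)
++-assoc-subst []       vs ws = refl
++-assoc-subst {m = suc m} {n} {k} (u ∷ us) vs ws =
  trans (subst-∷ (ℕₚ.+-assoc m n k)) (cong (u ∷_) (++-assoc-subst us vs ws))

++-identityʳ-subst : ∀ {A : Set} {m} (us : Vec A m) (vs : Vec A 0) →
                     subst (Vec A) (ℕₚ.+-identityʳ m) (us ++ vs) ≡ us
++-identityʳ-subst []       [] = refl
++-identityʳ-subst {m = suc m} (u ∷ us) vs =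
  trans (subst-∷ (ℕₚ.+-identityʳ m)) (cong (u ∷_) (++-identityʳ-subst us vs))

module Soundness (S : Signature) (I : Interpretation S) where
  open Signature S using (V; •)
  open Interpretation I
  open Circuits S
  open Denotation S I

  private variable
    l m n k x y : ℕ

  ≗-refl : (σ : Stream n) → σ ≗ˢ σ
  ≗-refl σ k = refl

  ≗-sym : {σ τ : Stream n} → σ ≗ˢ τ → τ ≗ˢ σ
  ≗-sym p k = sym (p k)

  infixr 2 _⊙_
  _⊙_ : {σ τ ρ : Stream n} → σ ≗ˢ τ → τ ≗ˢ ρ → σ ≗ˢ ρ
  (p ⊙ q) k = trans (p k) (q k)

  takeˢ : ∀ m → Stream (m + n) → Stream m
  takeˢ m σ = take m ∘ σ

  dropˢ : ∀ m → Stream (m + n) → Stream n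
  dropˢ m σ = drop m ∘ σ

  takeˢ-cong : ∀ m {σ τ : Stream (m + n)} → σ ≗ˢ τ → takeˢ m σ ≗ˢ takeˢ m τ
  takeˢ-cong m p k = cong (take m) (p k)

  dropˢ-cong : ∀ m {σ τ : Stream (m + n)} → σ ≗ˢ τ → dropˢ m σ ≗ˢ dropˢ m τ
  dropˢ-cong m p k = cong (drop m) (p k)

  ++ˢ-cong : {α α′ : Stream m} {β β′ : Stream n} → α ≗ˢ α′ → β ≗ˢ β′ → α ++ˢ β ≗ˢ α′ ++ˢ β′
  ++ˢ-cong p q k = cong₂ _++_ (p k) (q k)

  takeˢ-++ : (α : Stream m) (β : Stream n) → takeˢ m (α ++ˢ β) ≗ˢ α
  takeˢ-++ α β k = take-++ (α k) (β k)

  dropˢ-++ : (α : Stream m) (β : Stream n) → dropˢ m (α ++ˢ β) ≗ˢ β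
  dropˢ-++ α β k = drop-++ (α k) (β k)

  takeˢ++dropˢ : ∀ m (σ : Stream (m + n)) → takeˢ m σ ++ˢ dropˢ m σ ≗ˢ σ
  takeˢ++dropˢ m σ k = Vecₚ.take++drop≡id m (σ k)

  -- Causality takes the place of function extensionality: an output tick sees its input only
  -- through pointwise values.
  resp : (F : StreamFn m n) {σ τ : Stream m} → σ ≗ˢ τ → fun F σ ≗ˢ fun F τ
  resp F p k = causal F k (λ i _ → p i)

  infix 4 _≐_
  _≐_ : StreamFn m n → StreamFn m n → Set
  F ≐ G = ∀ σ → fun F σ ≗ˢ fun G σ

  ++ˢ-ext : {F G : StreamFn (m + n) k} → (∀ α β → fun F (α ++ˢ β) ≗ˢ fun G (α ++ˢ β)) → F ≐ G
  ++ˢ-ext {m = m} {F = F} {G} p σ =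
    resp F (≗-sym (takeˢ++dropˢ m σ)) ⊙ p (takeˢ m σ) (dropˢ m σ) ⊙ resp G (takeˢ++dropˢ m σ)

  ++ˢ-ext³ : {F G : StreamFn ((m + n) + k) l} →
             (∀ α β γ → fun F ((α ++ˢ β) ++ˢ γ) ≗ˢ fun G ((α ++ˢ β) ++ˢ γ)) → F ≐ G
  ++ˢ-ext³ {m = m} {n} {F = F} {G} p = ++ˢ-ext {m = m + n} {F = F} {G} (λ α γ →
    resp F (++ˢ-cong (≗-sym (takeˢ++dropˢ m α)) (≗-refl γ)) ⊙ p (takeˢ m α) (dropˢ m α) γ ⊙
    resp G (++ˢ-cong (takeˢ++dropˢ m α) (≗-refl γ)))

  parFn-++ : (F : StreamFn m n) (G : StreamFn k l) (α : Stream m) (β : Stream k) →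
             fun (parFn F G) (α ++ˢ β) ≗ˢ fun F α ++ˢ fun G β
  parFn-++ F G α β = ++ˢ-cong (resp F (takeˢ-++ α β)) (resp G (dropˢ-++ α β))

  swapˢ-++ : (α : Stream m) (β : Stream n) → fun ⟦ swap m n ⟧ (α ++ˢ β) ≗ˢ β ++ˢ α
  swapˢ-++ α β = ++ˢ-cong (dropˢ-++ α β) (takeˢ-++ α β)

  coeˢ : (p : m ≡ n) (σ : Stream m) → fun ⟦ coe p ⟧ σ ≗ˢ subst (Vec V) p ∘ σ
  coeˢ refl σ k = refl

  coe-symˢ : (p : m ≡ n) {σ : Stream m} {τ : Stream n} →
             fun ⟦ coe p ⟧ σ ≗ˢ τ → fun ⟦ coe (sym p) ⟧ τ ≗ˢ σ
  coe-symˢ refl q k = sym (q k)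

  assocˢ : (α : Stream m) (β : Stream n) (γ : Stream k) →
           fun ⟦ coe (ℕₚ.+-assoc m n k) ⟧ ((α ++ˢ β) ++ˢ γ) ≗ˢ α ++ˢ (β ++ˢ γ)
  assocˢ {m} {n} {k} α β γ =
    coeˢ (ℕₚ.+-assoc m n k) _ ⊙ λ i → ++-assoc-subst (α i) (β i) (γ i)

  assoc⁻ˢ : (α : Stream m) (β : Stream n) (γ : Stream k) →
            fun ⟦ coe (sym (ℕₚ.+-assoc m n k)) ⟧ (α ++ˢ (β ++ˢ γ)) ≗ˢ (α ++ˢ β) ++ˢ γ
  assoc⁻ˢ {m} {n} {k} α β γ = coe-symˢ (ℕₚ.+-assoc m n k) (assocˢ α β γ)

  identityʳˢ : (α : Stream m) (β : Stream 0) →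
               fun ⟦ coe (ℕₚ.+-identityʳ m) ⟧ (α ++ˢ β) ≗ˢ α
  identityʳˢ {m} α β = coeˢ (ℕₚ.+-identityʳ m) _ ⊙ λ i → ++-identityʳ-subst (α i) (β i)

  ≗⇒⊑ : {σ τ : Stream n} → σ ≗ˢ τ → σ ⊑ˢ τ
  ≗⇒⊑ {σ = σ} p k = subst (σ k ⊑ᵛ_) (p k) ⊑ᵛ-refl

  ⊑ˢ-trans : {σ τ ρ : Stream n} → σ ⊑ˢ τ → τ ⊑ˢ ρ → σ ⊑ˢ ρ
  ⊑ˢ-trans p q k = ⊑ᵛ-trans (p k) (q k)

  ⊑ˢ-antisym : {σ τ : Stream n} → σ ⊑ˢ τ → τ ⊑ˢ σ → σ ≗ˢ τ
  ⊑ˢ-antisym p q k = ⊑ᵛ-antisym (p k) (q k)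

  takeˢ-mono : ∀ m {σ τ : Stream (m + n)} → σ ⊑ˢ τ → takeˢ m σ ⊑ˢ takeˢ m τ
  takeˢ-mono m p k = take-mono m (p k)

  dropˢ-mono : ∀ m {σ τ : Stream (m + n)} → σ ⊑ˢ τ → dropˢ m σ ⊑ˢ dropˢ m τ
  dropˢ-mono m p k = drop-mono m (p k)

  ++ˢ-mono : {α α′ : Stream m} {β β′ : Stream n} → α ⊑ˢ α′ → β ⊑ˢ β′ → α ++ˢ β ⊑ˢ α′ ++ˢ β′
  ++ˢ-mono p q k = ++-mono (p k) (q k)

  loop : ∀ x (F : StreamFn (x + m) (x + n)) → Stream m → Stream x → Stream x
  loop {m} {n} x F σ τ = takeˢ x (fun F (τ ++ˢ σ))

  -- Leastness ranges over all pre-fixed points, not just fixed points: the comparison arguments for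
  -- sliding and vanishing produce only inequalities.
  record LeastFeedback x (F : StreamFn (x + m) (x + n)) (σ : Stream m) (μ : Stream x) : Set where
    field
      fixed : loop x F σ μ ≗ˢ μ
      least : ∀ τ → loop x F σ τ ⊑ˢ τ → μ ⊑ˢ τ
  open LeastFeedback

  μ : ∀ x (F : StreamFn (x + m) (x + n)) → Stream m → Stream x
  μ x F σ = lfp (loop x F σ)

  -- Each tick of `lfp` is read off some Kleene iterate, and by induction every iterate lies below
  -- every pre-fixed point.
  μ-least : ∀ x (F : StreamFn (x + m) (x + n)) σ → LeastFeedback x F σ (μ x F σ)
  μ-least {m} {n} x F σ = record
    { fixed = proj₁ (feedback-isLeastFixedPoint {x} {m} {n} F σ)
    ; least = λ τ p k → below τ p (bound x k) k
    }
    where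
    below : ∀ τ → loop x F σ τ ⊑ˢ τ → ∀ j → kleene (loop x F σ) j ⊑ˢ τ
    below τ p zero    k = ⊑ᵛ-minimum _
    below τ p (suc j) =
      ⊑ˢ-trans (takeˢ-mono x (monotone F (++ˢ-mono (below τ p j) (λ _ → ⊑ᵛ-refl)))) p

  LeastFeedback-unique : ∀ x {F : StreamFn (x + m) (x + n)} {σ μ ν} →
    LeastFeedback x F σ μ → LeastFeedback x F σ ν → μ ≗ˢ ν
  LeastFeedback-unique x p q =
    ⊑ˢ-antisym (least p _ (≗⇒⊑ (fixed q))) (least q _ (≗⇒⊑ (fixed p)))

  -- From here on the Kleene bound is out of sight: a trace may be computed at any stream with the
  -- universal property.
  trace-eval : ∀ x {F : StreamFn (x + m) (x + n)} {σ ν} → LeastFeedback x F σ ν →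
               fun (traceFn x F) σ ≗ˢ dropˢ x (fun F (ν ++ˢ σ))
  trace-eval x {F} {σ} p =
    dropˢ-cong x (resp F (++ˢ-cong (LeastFeedback-unique x (μ-least x F σ) p) (≗-refl σ)))

  LeastFeedback-transfer : ∀ x {m m′ n n′} {F : StreamFn (x + m) (x + n)}
    {G : StreamFn (x + m′) (x + n′)} {σ ρ ν} →
    (∀ τ → loop x F σ τ ≗ˢ loop x G ρ τ) → LeastFeedback x G ρ ν → LeastFeedback x F σ ν
  LeastFeedback-transfer x {ν = ν} p q = record
    { fixed = p ν ⊙ fixed q
    ; least = λ τ r → least q τ (⊑ˢ-trans (≗⇒⊑ (≗-sym (p τ))) r)
    }

  -- Two traces whose bodies feed back the same thing are compared at a common
  -- least fixed point.
  trace-ext : ∀ x {m m′ n n′} {F : StreamFn (x + m) (x + n)} {G : StreamFn (x + m′) (x + n′)}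
    {σ ρ} (φ : Stream n′ → Stream n) →
    (∀ τ → fun F (τ ++ˢ σ) ≗ˢ takeˢ x (fun G (τ ++ˢ ρ)) ++ˢ φ (dropˢ x (fun G (τ ++ˢ ρ)))) →
    fun (traceFn x F) σ ≗ˢ φ (fun (traceFn x G) ρ)
  trace-ext x {F = F} {G} {σ} {ρ} φ p =
    trace-eval x {F = F} (LeastFeedback-transfer x {F = F} {G}
      (λ τ → takeˢ-cong x (p τ) ⊙
             takeˢ-++ (loop x G ρ τ) (φ (dropˢ x (fun G (τ ++ˢ ρ))))) (μ-least x G ρ)) ⊙
    dropˢ-cong x (p ν) ⊙ dropˢ-++ (loop x G ρ ν) (φ (dropˢ x (fun G (ν ++ˢ ρ))))
    where ν = μ x G ρ

  trace-cong : ∀ x {F G : StreamFn (x + m) (x + n)} → F ≐ G → traceFn x F ≐ traceFn x G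
  trace-cong x {F} {G} p σ =
    trace-ext x {F = F} {G} (λ α → α) (λ τ → p (τ ++ˢ σ) ⊙ ≗-sym (takeˢ++dropˢ x (fun G (τ ++ˢ σ))))

  denotes : SCirc m n → Stream m → Stream n
  denotes f = fun ⟦ f ⟧

  ⊗-denotes : (f : SCirc m n) (g : SCirc k l) (α : Stream m) (β : Stream k) →
              denotes (f ⊗ g) (α ++ˢ β) ≗ˢ denotes f α ++ˢ denotes g β
  ⊗-denotes f g = parFn-++ ⟦ f ⟧ ⟦ g ⟧

  ⊗-denotes′ : (f : SCirc m n) (g : SCirc k l) {σ : Stream (m + k)} (α : Stream m) (β : Stream k) →
               σ ≗ˢ α ++ˢ β → denotes (f ⊗ g) σ ≗ˢ denotes f α ++ˢ denotes g β
  ⊗-denotes′ f g α β p = resp ⟦ f ⊗ g ⟧ p ⊙ ⊗-denotes f g α β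

  sound-assoc : (f : SCirc m n) (g : SCirc k l) (h : SCirc x y) →
    SameDenotation (((f ⊗ g) ⊗ h) ⨟ coe (ℕₚ.+-assoc n l y)) (coe (ℕₚ.+-assoc m k x) ⨟ (f ⊗ (g ⊗ h)))
  sound-assoc {m} {n} {k} {l} {x} {y} f g h =
    ++ˢ-ext³ {m} {k} {x} {F = ⟦ lhs ⟧} {⟦ rhs ⟧} λ α β γ →
      resp ⟦ coe (ℕₚ.+-assoc n l y) ⟧
        (⊗-denotes (f ⊗ g) h (α ++ˢ β) γ ⊙ ++ˢ-cong (⊗-denotes f g α β) (≗-refl (denotes h γ))) ⊙
      assocˢ (denotes f α) (denotes g β) (denotes h γ) ⊙
      ≗-sym (⊗-denotes′ f (g ⊗ h) α (β ++ˢ γ) (assocˢ α β γ) ⊙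
             ++ˢ-cong (≗-refl (denotes f α)) (⊗-denotes g h β γ))
    where
    lhs = ((f ⊗ g) ⊗ h) ⨟ coe (ℕₚ.+-assoc n l y)
    rhs = coe (ℕₚ.+-assoc m k x) ⨟ (f ⊗ (g ⊗ h))

  sound-hexagon : ∀ m n k →
    SameDenotation (coe (ℕₚ.+-assoc m n k) ⨟ swap m (n + k) ⨟ coe (ℕₚ.+-assoc n k m))
                   ((swap m n ⊗ id k) ⨟ coe (ℕₚ.+-assoc n m k) ⨟ (id n ⊗ swap m k))
  sound-hexagon m n k = ++ˢ-ext³ {m} {n} {k} {F = ⟦ lhs ⟧} {⟦ rhs ⟧} λ α β γ →
      resp ⟦ coe (ℕₚ.+-assoc n k m) ⟧
        (resp ⟦ swap m (n + k) ⟧ (assocˢ α β γ) ⊙ swapˢ-++ α (β ++ˢ γ)) ⊙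
      assocˢ β γ α ⊙
      ≗-sym (⊗-denotes′ (id n) (swap m k) β (α ++ˢ γ)
               (resp ⟦ coe (ℕₚ.+-assoc n m k) ⟧
                  (⊗-denotes (swap m n) (id k) (α ++ˢ β) γ ⊙
                   ++ˢ-cong (swapˢ-++ α β) (≗-refl γ)) ⊙
                assocˢ β α γ) ⊙
             ++ˢ-cong (≗-refl β) (swapˢ-++ α γ))
    where
    lhs = coe (ℕₚ.+-assoc m n k) ⨟ swap m (n + k) ⨟ coe (ℕₚ.+-assoc n k m)
    rhs = (swap m n ⊗ id k) ⨟ coe (ℕₚ.+-assoc n m k) ⨟ (id n ⊗ swap m k)

  sound-tighten : ∀ x (f : SCirc m n) (g : SCirc (x + n) (x + k)) (h : SCirc k l) →
    SameDenotation (Tr x ((id x ⊗ f) ⨟ g ⨟ (id x ⊗ h))) (f ⨟ Tr x g ⨟ h)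
  sound-tighten x f g h σ =
    trace-ext x {F = ⟦ (id x ⊗ f) ⨟ g ⨟ (id x ⊗ h) ⟧} {⟦ g ⟧} (denotes h) λ τ →
      ++ˢ-cong (takeˢ-cong x (resp ⟦ g ⟧ (⊗-denotes (id x) f τ σ)))
               (resp ⟦ h ⟧ (dropˢ-cong x (resp ⟦ g ⟧ (⊗-denotes (id x) f τ σ))))

  -- The rolling rule: if `ν` is the least fixed point of `f` after `φ`, then `φ ν` is that of `φ`
  -- after `f`.
  sound-slide : ∀ x y (f : SCirc x y) (g : SCirc (y + m) (x + n)) →
    SameDenotation (Tr x ((f ⊗ id m) ⨟ g)) (Tr y (g ⨟ (f ⊗ id n)))
  sound-slide {m} {n} x y f g σ =
    trace-eval x {F = ⟦ F ⟧} {ν = φ ν} record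
      { fixed = F-++ (φ ν) ⊙ φ-cong ν-fixed
      ; least = λ τ p →
          -- If `τ` is pre-fixed for `φ` after `f`, then the image of `τ` under `f` is pre-fixed for
          -- `f` after `φ`, hence above `ν`; applying `φ` returns below `τ`.
          let q = ⊑ˢ-trans (≗⇒⊑ (≗-sym (F-++ τ))) p
          in ⊑ˢ-trans (φ-mono (ν-below (denotes f τ) (monotone ⟦ f ⟧ q))) q
      } ⊙
    dropˢ-cong x (resp ⟦ g ⟧ (⊗-denotes f (id m) (φ ν) σ ⊙ ++ˢ-cong ν-fixed (≗-refl σ))) ⊙
    ≗-sym (dropˢ-++ (denotes f (φ ν)) (dropˢ x (denotes g (ν ++ˢ σ))))
    where
    F = (f ⊗ id m) ⨟ g
    G = g ⨟ (f ⊗ id n)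
    φ : Stream y → Stream x
    φ τ = takeˢ x (denotes g (τ ++ˢ σ))
    φ-cong : ∀ {τ τ′} → τ ≗ˢ τ′ → φ τ ≗ˢ φ τ′
    φ-cong p = takeˢ-cong x (resp ⟦ g ⟧ (++ˢ-cong p (≗-refl σ)))
    φ-mono : ∀ {τ τ′} → τ ⊑ˢ τ′ → φ τ ⊑ˢ φ τ′
    φ-mono p = takeˢ-mono x (monotone ⟦ g ⟧ (++ˢ-mono p (≗⇒⊑ (≗-refl σ))))
    F-++ : ∀ τ → loop x ⟦ F ⟧ σ τ ≗ˢ φ (denotes f τ)
    F-++ τ = takeˢ-cong x (resp ⟦ g ⟧ (⊗-denotes f (id m) τ σ))
    ν : Stream y
    ν = μ y ⟦ G ⟧ σ
    G-++ : ∀ τ → loop y ⟦ G ⟧ σ τ ≗ˢ denotes f (φ τ)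
    G-++ τ = takeˢ-++ (denotes f (φ τ)) (dropˢ x (denotes g (τ ++ˢ σ)))
    ν-fixed : denotes f (φ ν) ≗ˢ ν
    ν-fixed = ≗-sym (G-++ ν) ⊙ fixed (μ-least y ⟦ G ⟧ σ)
    ν-below : ∀ τ → denotes f (φ τ) ⊑ˢ τ → ν ⊑ˢ τ
    ν-below τ p = least (μ-least y ⟦ G ⟧ σ) τ (⊑ˢ-trans (≗⇒⊑ (G-++ τ)) p)

  sound-vanish₀ : (f : SCirc m n) → SameDenotation (Tr 0 f) f
  sound-vanish₀ f σ = resp ⟦ f ⟧ (++ˢ-cong {α′ = λ _ → []} (λ k → []-unique _) (≗-refl σ))

  -- Bekić: a least fixed point in two components is computed componentwise.
  sound-vanish₊ : ∀ x y (f : SCirc ((x + y) + m) ((x + y) + n)) →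
    SameDenotation (Tr (x + y) f)
      (Tr y (Tr x (coe (sym (ℕₚ.+-assoc x y m)) ⨟ f ⨟ coe (ℕₚ.+-assoc x y n))))
  sound-vanish₊ {m} {n} x y f σ =
    trace-eval (x + y) {F = ⟦ f ⟧} {ν = α ν ++ˢ ν} record
      { fixed = ≗-sym (takeˢ++dropˢ x (takeˢ (x + y) (denotes f ((α ν ++ˢ ν) ++ˢ σ)))) ⊙
                ++ˢ-cong (α-fixed ν) ν-fixed
      ; least = λ τ p →
          -- For a pre-fixed pair `(a , b)`, the inner solution `α b` lies below `a`, so by
          -- monotonicity `b` is pre-fixed for the outer loop and `ν` lies below `b`. Monotonicity
          -- of `α` then bounds the first component.
          let a  = takeˢ x τ
              b  = dropˢ x τ
              q  = ⊑ˢ-trans (≗⇒⊑ (takeˢ-cong (x + y) (resp ⟦ f ⟧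
                     (++ˢ-cong (takeˢ++dropˢ x τ) (≗-refl σ))))) p
              αb⊑a : α b ⊑ˢ a
              αb⊑a = α-below b a (takeˢ-mono x q)
              ν⊑b : ν ⊑ˢ b
              ν⊑b = ν-below b (⊑ˢ-trans
                (dropˢ-mono x (takeˢ-mono (x + y) (monotone ⟦ f ⟧
                  (++ˢ-mono (++ˢ-mono αb⊑a (≗⇒⊑ (≗-refl b))) (≗⇒⊑ (≗-refl σ))))))
                (dropˢ-mono x q))
              αν⊑αb : α ν ⊑ˢ α b
              αν⊑αb = α-below ν (α b) (⊑ˢ-trans
                (takeˢ-mono x (takeˢ-mono (x + y) (monotone ⟦ f ⟧
                  (++ˢ-mono (++ˢ-mono (≗⇒⊑ (≗-refl (α b))) ν⊑b) (≗⇒⊑ (≗-refl σ))))))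
                (≗⇒⊑ (α-fixed b)))
          in ⊑ˢ-trans (++ˢ-mono (⊑ˢ-trans αν⊑αb αb⊑a) ν⊑b) (≗⇒⊑ (takeˢ++dropˢ x τ))
      } ⊙
    ≗-sym (dropˢ-cong y (inner-out ν) ⊙ dropˢ-++ (f₂ (α ν) ν) (f₃ (α ν) ν))
    where
    g = coe (sym (ℕₚ.+-assoc x y m)) ⨟ f ⨟ coe (ℕₚ.+-assoc x y n)
    f₁ : Stream x → Stream y → Stream x
    f₁ a b = takeˢ x (takeˢ (x + y) (denotes f ((a ++ˢ b) ++ˢ σ)))
    f₂ : Stream x → Stream y → Stream y
    f₂ a b = dropˢ x (takeˢ (x + y) (denotes f ((a ++ˢ b) ++ˢ σ)))
    f₃ : Stream x → Stream y → Stream n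
    f₃ a b = dropˢ (x + y) (denotes f ((a ++ˢ b) ++ˢ σ))
    g-++ : ∀ a b → denotes g (a ++ˢ (b ++ˢ σ)) ≗ˢ f₁ a b ++ˢ (f₂ a b ++ˢ f₃ a b)
    g-++ a b = resp ⟦ coe (ℕₚ.+-assoc x y n) ⟧
        (resp ⟦ f ⟧ (assoc⁻ˢ a b σ) ⊙
         ≗-sym (takeˢ++dropˢ (x + y) r) ⊙
         ++ˢ-cong (≗-sym (takeˢ++dropˢ x (takeˢ (x + y) r))) (≗-refl (f₃ a b))) ⊙
      assocˢ (f₁ a b) (f₂ a b) (f₃ a b)
      where r = denotes f ((a ++ˢ b) ++ˢ σ)
    α : Stream y → Stream x
    α b = μ x ⟦ g ⟧ (b ++ˢ σ)
    g-loop : ∀ a b → loop x ⟦ g ⟧ (b ++ˢ σ) a ≗ˢ f₁ a b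
    g-loop a b = takeˢ-cong x (g-++ a b) ⊙ takeˢ-++ (f₁ a b) (f₂ a b ++ˢ f₃ a b)
    α-fixed : ∀ b → f₁ (α b) b ≗ˢ α b
    α-fixed b = ≗-sym (g-loop (α b) b) ⊙ fixed (μ-least x ⟦ g ⟧ (b ++ˢ σ))
    α-below : ∀ b a → f₁ a b ⊑ˢ a → α b ⊑ˢ a
    α-below b a p = least (μ-least x ⟦ g ⟧ (b ++ˢ σ)) a (⊑ˢ-trans (≗⇒⊑ (g-loop a b)) p)
    inner-out : ∀ b → denotes (Tr x g) (b ++ˢ σ) ≗ˢ f₂ (α b) b ++ˢ f₃ (α b) b
    inner-out b = dropˢ-cong x (g-++ (α b) b) ⊙ dropˢ-++ (f₁ (α b) b) (f₂ (α b) b ++ˢ f₃ (α b) b)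
    ν : Stream y
    ν = μ y ⟦ Tr x g ⟧ σ
    outer-loop : ∀ b → loop y ⟦ Tr x g ⟧ σ b ≗ˢ f₂ (α b) b
    outer-loop b = takeˢ-cong y (inner-out b) ⊙ takeˢ-++ (f₂ (α b) b) (f₃ (α b) b)
    ν-fixed : f₂ (α ν) ν ≗ˢ ν
    ν-fixed = ≗-sym (outer-loop ν) ⊙ fixed (μ-least y ⟦ Tr x g ⟧ σ)
    ν-below : ∀ b → f₂ (α b) b ⊑ˢ b → ν ⊑ˢ b
    ν-below b p = least (μ-least y ⟦ Tr x g ⟧ σ) b (⊑ˢ-trans (≗⇒⊑ (outer-loop b)) p)

  sound-superpose : ∀ x (f : SCirc (x + m) (x + n)) (g : SCirc k l) →
    SameDenotation (Tr x f ⊗ g)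
      (Tr x (coe (sym (ℕₚ.+-assoc x m k)) ⨟ (f ⊗ g) ⨟ coe (ℕₚ.+-assoc x n l)))
  sound-superpose {m} {n} {k} {l} x f g = ++ˢ-ext {m} {k} {F = ⟦ Tr x f ⊗ g ⟧} {⟦ Tr x h ⟧} λ α β →
    ⊗-denotes (Tr x f) g α β ⊙
    ≗-sym (trace-ext x {F = ⟦ h ⟧} {⟦ f ⟧} (_++ˢ denotes g β) λ τ →
      let r = denotes f (τ ++ˢ α) in
      resp ⟦ coe (ℕₚ.+-assoc x n l) ⟧
        (⊗-denotes′ f g (τ ++ˢ α) β (assoc⁻ˢ τ α β) ⊙
         ++ˢ-cong (≗-sym (takeˢ++dropˢ x r)) (≗-refl (denotes g β))) ⊙
      assocˢ (takeˢ x r) (dropˢ x r) (denotes g β))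
    where
    h = coe (sym (ℕₚ.+-assoc x m k)) ⨟ (f ⊗ g) ⨟ coe (ℕₚ.+-assoc x n l)

  -- The map fed back is constantly the input, which is therefore its only fixed point.
  sound-yank : ∀ x → SameDenotation (Tr x (swap x x)) (id x)
  sound-yank x σ =
    trace-eval x {F = ⟦ swap x x ⟧} {ν = σ} record
      { fixed = fed σ
      ; least = λ τ p → ⊑ˢ-trans (≗⇒⊑ (≗-sym (fed τ))) p
      } ⊙
    dropˢ-cong x (swapˢ-++ σ σ) ⊙ dropˢ-++ σ σ
    where
    fed : ∀ τ → loop x ⟦ swap x x ⟧ σ τ ≗ˢ σ
    fed τ = takeˢ-cong x (swapˢ-++ τ σ) ⊙ takeˢ-++ σ τ

  sound : {f g : SCirc m n} → f ≈ g → SameDenotation f g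
  sound ≈-refl        σ = ≗-refl _
  sound (≈-sym p)     σ = ≗-sym (sound p σ)
  sound (≈-trans p q) σ = sound p σ ⊙ sound q σ
  sound (⨟-cong {f′ = f′} {g = g} p q) σ = resp ⟦ g ⟧ (sound p σ) ⊙ sound q (denotes f′ σ)
  sound (⊗-cong {m = m} p q) σ = ++ˢ-cong (sound p (takeˢ m σ)) (sound q (dropˢ m σ))
  sound (Tr-cong {x} {f = f} {f′} p) = trace-cong x {⟦ f ⟧} {⟦ f′ ⟧} (sound p)
  sound ⨟-identityˡ   σ = ≗-refl _
  sound ⨟-identityʳ   σ = ≗-refl _
  sound ⨟-assoc       σ = ≗-refl _
  sound (⊗-id {m})    σ = takeˢ++dropˢ m σ
  sound (⊗-interchange {m} {f = f} {g} {f′} {g′}) σ =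
    ≗-sym (⊗-denotes g g′ (denotes f (takeˢ m σ)) (denotes f′ (dropˢ m σ)))
  sound ⊗-identityˡ   σ = ≗-refl _
  sound (⊗-identityʳ {m} {n} {f}) =
    ++ˢ-ext {m} {0} {F = ⟦ (f ⊗ id 0) ⨟ coe (ℕₚ.+-identityʳ n) ⟧}
            {⟦ coe (ℕₚ.+-identityʳ m) ⨟ f ⟧} λ α β →
      resp ⟦ coe (ℕₚ.+-identityʳ n) ⟧ (⊗-denotes f (id 0) α β) ⊙
      identityʳˢ (denotes f α) β ⊙
      ≗-sym (resp ⟦ f ⟧ (identityʳˢ α β))
  sound (⊗-assoc {f = f} {g} {h}) = sound-assoc f g h
  sound (swap-natural {m} {n} {k} {l} {f} {g}) =
    ++ˢ-ext {m} {k} {F = ⟦ (f ⊗ g) ⨟ swap n l ⟧} {⟦ swap m k ⨟ (g ⊗ f) ⟧} λ α β →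
      resp ⟦ swap n l ⟧ (⊗-denotes f g α β) ⊙ swapˢ-++ (denotes f α) (denotes g β) ⊙
      ≗-sym (⊗-denotes′ g f β α (swapˢ-++ α β))
  sound (swap-involutive {m} {n}) =
    ++ˢ-ext {m} {n} {F = ⟦ swap m n ⨟ swap n m ⟧} {⟦ id (m + n) ⟧} λ α β →
      resp ⟦ swap n m ⟧ (swapˢ-++ α β) ⊙ swapˢ-++ β α
  sound (swap-hexagon {m} {n} {k}) = sound-hexagon m n k
  sound (Tr-tighten {x} {f = f} {g} {h}) = sound-tighten x f g h
  sound (Tr-slide {x} {y} {f = f} {g}) = sound-slide x y f g
  sound (Tr-vanish₀ {f = f}) = sound-vanish₀ f
  sound (Tr-vanish₊ {x} {y} {f = f}) = sound-vanish₊ x y f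
  sound (Tr-superpose {x} {f = f} {g}) = sound-superpose x f g
  sound (Tr-yank {x}) = sound-yank x

-- Soundness of the reduction rules.

take-replicate : ∀ {A : Set} m {n} (a : A) → take m (replicate (m + n) a) ≡ replicate m a
take-replicate zero    a = refl
take-replicate (suc m) a = cong (a ∷_) (take-replicate m a)

drop-replicate : ∀ {A : Set} m {n} (a : A) → drop m (replicate (m + n) a) ≡ replicate n a
drop-replicate zero    a = refl
drop-replicate (suc m) a = drop-replicate m a

module RuleSoundness (S : Signature) (I : Interpretation S) where
  open Signature S using (V; •; _≟_)
  open Interpretation I
  open Circuits S
  open Denotation S I
  open Reduction S I
  open PROP S
  open Productivity S I
  open Soundness S I
  private module L = IsLattice isLattice

  private variable
    l m n k x y : ℕ

  ⊔-identityˡ : ∀ v → • ⊔ v ≡ v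
  ⊔-identityˡ v = L.antisym (L.∨-least (minimum v) L.refl) (L.y≤x∨y • v)

  ⊔-identityʳ : ∀ v → v ⊔ • ≡ v
  ⊔-identityʳ v = L.antisym (L.∨-least L.refl (minimum v)) (L.x≤x∨y v •)

  ⊥ⁿ : Vec V n
  ⊥ⁿ {n} = replicate n •

  ++-⊥ : ∀ m {n} → ⊥ⁿ {m} ++ ⊥ⁿ {n} ≡ ⊥ⁿ
  ++-⊥ zero    = refl
  ++-⊥ (suc m) = cong (• ∷_) (++-⊥ m)

  -- Evaluation of combinational circuits

  eval-denotes : ∀ (h : CCirc m n) σ k → denotes ⌜ h ⌝ σ k ≡ eval h (σ k)
  eval-denotes (gen (prim p)) σ k = refl
  eval-denotes (gen fork)     σ k with _ ∷ [] ← σ k = refl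
  eval-denotes (gen join)     σ k with _ ∷ _ ∷ [] ← σ k = refl
  eval-denotes (gen intro)    σ k = refl
  eval-denotes (gen elim)     σ k = refl
  eval-denotes (id n)         σ k = refl
  eval-denotes (f ⨟ g)        σ k =
    trans (eval-denotes g _ k) (cong (eval g) (eval-denotes f σ k))
  eval-denotes (_⊗_ {m = m} f g) σ k =
    cong₂ _++_ (eval-denotes f (takeˢ m σ) k) (eval-denotes g (dropˢ m σ) k)
  eval-denotes (swap m n)     σ k = refl

  eval-mono : (h : CCirc m n) {us vs : Vec V m} → us ⊑ᵛ vs → eval h us ⊑ᵛ eval h vs
  eval-mono h {us} {vs} p =
    subst (_⊑ᵛ eval h vs) (eval-denotes h (λ _ → us) 0)
      (subst (denotes ⌜ h ⌝ (λ _ → us) 0 ⊑ᵛ_) (eval-denotes h (λ _ → vs) 0)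
        (monotone ⟦ ⌜ h ⌝ ⟧ (λ _ → p) 0))

  -- A value is present at tick 0 only and `•` afterwards. Preservation of `•` is what lets a value
  -- pushed through a combinational circuit remain of this form.
  eval-⊥ : (h : CCirc m n) → eval h ⊥ⁿ ≡ ⊥ⁿ
  eval-⊥ (gen (prim p)) = ⊥-presₚ p
  eval-⊥ (gen fork)     = refl
  eval-⊥ (gen join)     = cong (_∷ []) (⊔-identityˡ •)
  eval-⊥ (gen intro)    = refl
  eval-⊥ (gen elim)     = refl
  eval-⊥ (id n)         = refl
  eval-⊥ (f ⨟ g)        = trans (cong (eval g) (eval-⊥ f)) (eval-⊥ g)
  eval-⊥ (_⊗_ {m = m} {n = n} {k = k} f g) = trans
    (cong₂ _++_ (trans (cong (eval f) (take-replicate m •)) (eval-⊥ f))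
                (trans (cong (eval g) (drop-replicate m •)) (eval-⊥ g)))
    (++-⊥ n)
  eval-⊥ (swap m n)     = trans (cong₂ _++_ (drop-replicate m •) (take-replicate m •)) (++-⊥ n)

  eval-⊗ : (f : CCirc m n) (g : CCirc k l) (us : Vec V m) (vs : Vec V k) →
           eval (f ⊗ g) (us ++ vs) ≡ eval f us ++ eval g vs
  eval-⊗ f g us vs = cong₂ _++_ (cong (eval f) (take-++ us vs)) (cong (eval g) (drop-++ us vs))

  eval-coe : (p : m ≡ n) (us : Vec V m) → eval (coeᶜ p) us ≡ subst (Vec V) p us
  eval-coe refl us = refl

  eval-intros : ∀ n (us : Vec V 0) → eval (intros n) us ≡ ⊥ⁿ
  eval-intros zero    us = []-unique us
  eval-intros (suc n) us = cong (• ∷_) (eval-intros n us)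

  eval-forks : (us : Vec V n) → eval (forks n) us ≡ us ++ us
  eval-forks [] = refl
  eval-forks {suc n} (u ∷ us) = cong (u ∷_)
    (trans (cong (eval (coeᶜ (ℕₚ.+-assoc n 1 n)))
             (cong₂ _++_ (cong (_++ (u ∷ [])) (trans (cong (take n) (eval-forks us)) (take-++ us us)))
                         (trans (cong (drop n) (eval-forks us)) (drop-++ us us))))
      (trans (eval-coe (ℕₚ.+-assoc n 1 n) ((us ++ (u ∷ [])) ++ us)) (++-assoc-subst us (u ∷ []) us)))

  pulse : Vec V n → Stream n
  pulse vs = cons vs (λ _ → ⊥ⁿ)

  value-denotes : ∀ v σ → denotes (value v) σ ≗ˢ pulse (v ∷ [])
  value-denotes v σ k with v ≟ •
  value-denotes v σ zero    | yes refl = refl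
  value-denotes v σ (suc k) | yes refl = refl
  value-denotes v σ zero    | no _     = refl
  value-denotes v σ (suc k) | no _     = refl

  values-denotes : ∀ (vs : Vec V n) σ → denotes (values vs) σ ≗ˢ pulse vs
  values-denotes [] σ k = trans ([]-unique _) (sym ([]-unique _))
  values-denotes (v ∷ vs) σ =
    ++ˢ-cong (value-denotes v (λ _ → [])) (values-denotes vs σ) ⊙ λ where
      zero    → refl
      (suc k) → refl

  δs-denotes : ∀ n (σ : Stream n) → denotes (δs n) σ ≗ˢ cons ⊥ⁿ σ
  δs-denotes zero    σ k = trans ([]-unique _) (sym ([]-unique _))
  δs-denotes (suc n) σ =
    ++ˢ-cong (≗-refl (denotes (gen δ) (takeˢ 1 σ))) (δs-denotes n (dropˢ 1 σ)) ⊙ λ where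
      zero    → refl
      (suc k) → Vecₚ.take++drop≡id 1 (σ k)

  reg₁-denotes : ∀ v σ → denotes (reg₁ v) σ ≗ˢ cons (v ∷ []) σ
  reg₁-denotes v σ =
    resp ⟦ join ⟧ᶜ (++ˢ-cong (value-denotes v (λ _ → [])) (≗-refl (denotes (gen δ) σ))) ⊙
    eval-denotes (gen join) (pulse (v ∷ []) ++ˢ denotes (gen δ) σ) ⊙ λ where
      zero    → cong (_∷ []) (⊔-identityʳ v)
      (suc k) → joined (σ k)
    where
    joined : ∀ us → evalᵍ join (• ∷ us) ≡ us
    joined (u ∷ []) = cong (_∷ []) (⊔-identityˡ u)

  reg-denotes : ∀ (vs : Vec V n) σ → denotes (reg vs) σ ≗ˢ cons vs σ
  reg-denotes [] σ k = trans ([]-unique _) (sym ([]-unique _))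
  reg-denotes (v ∷ vs) σ =
    sound (reg-∷ v vs) σ ⊙
    ++ˢ-cong (reg₁-denotes v (takeˢ 1 σ)) (reg-denotes vs (dropˢ 1 σ)) ⊙ λ where
      zero    → refl
      (suc k) → Vecₚ.take++drop≡id 1 (σ k)

  values-eval-denotes : ∀ (h : CCirc m n) (us : Vec V m) →
                        SameDenotation (values us ⨟ ⌜ h ⌝) (values (eval h us))
  values-eval-denotes h us σ =
    resp ⟦ ⌜ h ⌝ ⟧ (values-denotes us σ) ⊙ eval-denotes h (pulse us) ⊙
    (λ where
      zero    → refl
      (suc k) → eval-⊥ h) ⊙
    ≗-sym (values-denotes (eval h us) σ)

  -- A value is a register whose input is constantly `•`, so `δs y ⊗ values vs` and `J ⨟ reg u`
  -- denote the same function. Only this exchange is semantic; the rest slides the introductions in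
  -- `J` round the loop within the free traced PROP.
  mealy-sound : ∀ x y z {m n} (f̂ : CCirc ((x + y) + (z + m)) ((x + y) + n)) (vs : Vec V z) →
    SameDenotation
      (Tr (x + y) (((id x ⊗ δs y) ⊗ (values vs ⊗ id m)) ⨟ ⌜ f̂ ⌝))
      (Tr ((x + y) + z)
        ( coe (cong (_+ m) (ℕₚ.+-assoc x y z))
        ⨟ ((id x ⊗ reg (replicate y • ++ vs)) ⊗ id m)
        ⨟ coe (trans (cong (_+ m) (sym (ℕₚ.+-assoc x y z))) (ℕₚ.+-assoc (x + y) z m))
        ⨟ ⌜ f̂ ⌝
        ⨟ (id (x + y) ⊗ (⌜ intros z ⌝ ⊗ id n))
        ⨟ coe (sym (ℕₚ.+-assoc (x + y) z n))))
  mealy-sound x y z {m} {n} f̂ vs σ =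
    sound (≋⇒≈ exposed) σ ⊙
    trace-cong (x + (y + 0)) {⟦ (D ⊗ id m) ⨟ ⌜ f′ ⌝ ⟧} {⟦ (D′ ⊗ id m) ⨟ ⌜ f′ ⌝ ⟧}
      (λ ρ → resp ⟦ ⌜ f′ ⌝ ⟧ (++ˢ-cong
        (++ˢ-cong (≗-refl (takeˢ x (takeˢ (x + (y + 0)) ρ)))
                  (initialised (dropˢ x (takeˢ (x + (y + 0)) ρ))))
        (≗-refl (dropˢ (x + (y + 0)) ρ)))) σ ⊙
    sound (≋⇒≈ slid) σ
    where
    u = replicate y • ++ vs
    J : SCirc (y + 0) (y + z)
    J = id y ⊗ ⌜ intros z ⌝
    A : SCirc ((x + (y + z)) + m) ((x + (y + z)) + m)
    A = (id x ⊗ reg u) ⊗ id m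
    coe₁ : (x + (y + z)) + m ≡ (x + y) + (z + m)
    coe₁ = trans (cong (_+ m) (sym (ℕₚ.+-assoc x y z))) (ℕₚ.+-assoc (x + y) z m)
    coe₂ : (x + y) + n ≡ (x + (y + 0)) + n
    coe₂ = cong (λ j → (x + j) + n) (sym (ℕₚ.+-identityʳ y))
    f′ : CCirc ((x + (y + z)) + m) ((x + (y + 0)) + n)
    f′ = coeᶜ coe₁ ⨟ f̂ ⨟ coeᶜ coe₂
    blank : (id x ⊗ J) ⊗ id n ≋ id (x + y) ⊗ (⌜ intros z ⌝ ⊗ id n)
    blank = ≋-trans (⊗-cong≋ (≋-sym ⊗-assoc≋) ≋-refl)
              (≋-trans ⊗-assoc≋ (⊗-cong≋ (≈⇒≋ ⊗-id) ≋-refl))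
    D D′ : SCirc (x + (y + 0)) (x + (y + z))
    D  = id x ⊗ (δs y ⊗ values vs)
    D′ = id x ⊗ (J ⨟ reg u)
    exposed : Tr (x + y) (((id x ⊗ δs y) ⊗ (values vs ⊗ id m)) ⨟ ⌜ f̂ ⌝) ≋
              Tr (x + (y + 0)) ((D ⊗ id m) ⨟ ⌜ f′ ⌝)
    exposed = Tr-cong≋ (cong (x +_) (sym (ℕₚ.+-identityʳ y))) refl refl
      (⨟-cong≋ (≋-trans regroup (≋-sym ⊗-assoc≋)) (≋-sym (coeᶜ² coe₁ coe₂)))
    slid : Tr (x + (y + 0)) ((D′ ⊗ id m) ⨟ ⌜ f′ ⌝) ≋
      Tr ((x + y) + z)
        ( coe (cong (_+ m) (ℕₚ.+-assoc x y z)) ⨟ A ⨟ coe coe₁ ⨟ ⌜ f̂ ⌝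
        ⨟ (id (x + y) ⊗ (⌜ intros z ⌝ ⊗ id n)) ⨟ coe (sym (ℕₚ.+-assoc (x + y) z n)))
    slid = begin
      Tr (x + (y + 0)) ((D′ ⊗ id m) ⨟ ⌜ f′ ⌝)
        ≈⟨ Tr-cong (≈-trans (⨟-congˡ (≈-trans (⊗-cong id⊗-⨟ ≈-refl) ⊗id-⨟)) ⨟-assoc) ⟩
      Tr (x + (y + 0)) (((id x ⊗ J) ⊗ id m) ⨟ (A ⨟ ⌜ f′ ⌝)) ≈⟨ Tr-slide ⟩
      Tr (x + (y + z)) ((A ⨟ ⌜ f′ ⌝) ⨟ ((id x ⊗ J) ⊗ id n))
        ≋⟨ Tr-cong≋ (sym (ℕₚ.+-assoc x y z)) refl refl (begin
             (A ⨟ ⌜ f′ ⌝) ⨟ ((id x ⊗ J) ⊗ id n) ≈⟨ ≈-trans ⨟-assoc (⨟-congʳ ⨟-assoc) ⟩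
             A ⨟ (⌜ coeᶜ coe₁ ⌝ ⨟ ⌜ f̂ ⌝ ⨟ (⌜ coeᶜ coe₂ ⌝ ⨟ ((id x ⊗ J) ⊗ id n)))
               ≋⟨ ⨟-cong≋ ≋-refl (⨟-cong≋ ≋-refl (≋-trans (coeᶜˡ coe₂) blank)) ⟩
             A ⨟ (⌜ coeᶜ coe₁ ⌝ ⨟ ⌜ f̂ ⌝ ⨟ (id (x + y) ⊗ (⌜ intros z ⌝ ⊗ id n)))
               ≋⟨ uncast _ coe₁ _ ⟨
             _ ∎) ⟩
      _ ∎
    initialised : SameDenotation (δs y ⊗ values vs) (J ⨟ reg u)
    initialised = ++ˢ-ext {y} {0} {F = ⟦ δs y ⊗ values vs ⟧} {⟦ J ⨟ reg u ⟧} λ α β →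
      ⊗-denotes (δs y) (values vs) α β ⊙
      ++ˢ-cong (δs-denotes y α) (values-denotes vs β) ⊙
      (λ where
        zero    → refl
        (suc k) → cong (α k ++_) (sym (trans (eval-denotes (intros z) β k) (eval-intros z (β k))))) ⊙
      ≗-sym (resp ⟦ reg u ⟧ (⊗-denotes (id y) ⌜ intros z ⌝ α β) ⊙
             reg-denotes u (α ++ˢ denotes ⌜ intros z ⌝ β))

  -- A combinational circuit acts tick by tick, so it passes through the prefixing of a value at the
  -- cost of being applied to that value.
  str-sound : (h : CCirc m n) (vs : Vec V m) →
    SameDenotation (reg vs ⨟ ⌜ h ⌝) (((values vs ⨟ ⌜ h ⌝) ⊗ (⌜ h ⌝ ⨟ δs n)) ⨟ ⌜ joins n ⌝)
  str-sound {n = n} h vs σ =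
    resp ⟦ ⌜ h ⌝ ⟧ (reg-denotes vs σ) ⊙ eval-denotes h (cons vs σ) ⊙
    (λ where
      zero    → refl
      (suc k) → sym (eval-denotes h σ k)) ⊙
    ≗-sym (resp ⟦ ⌜ joins n ⌝ ⟧ (++ˢ-cong (values-eval-denotes h vs (λ _ → [])) (≗-refl _)) ⊙
           sound (reg-pull ⌜ h ⌝ (eval h vs)) σ ⊙
           reg-denotes (eval h vs) (denotes ⌜ h ⌝ σ))

  -- Kleene iteration within a single tick

  module _ {x a b} (h : CCirc (x + a) (x + b)) (s : Vec V a) where
    private
      step : Vec V x → Vec V x
      step u = take x (eval h (u ++ s))

    approx : ℕ → Vec V x
    approx zero    = ⊥ⁿ
    approx (suc k) = step (approx k)

    step-mono : ∀ {u v} → u ⊑ᵛ v → step u ⊑ᵛ step v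
    step-mono p = take-mono x (eval-mono h (++-mono p ⊑ᵛ-refl))

    approx-up : ∀ k → approx k ⊑ᵛ approx (suc k)
    approx-up zero    = ⊑ᵛ-minimum _
    approx-up (suc k) = step-mono (approx-up k)

    approx-constant : ∀ {i d} → i ≤ d → approx i ≡ approx (suc i) → approx d ≡ approx (suc d)
    approx-constant {d = zero}  z≤n p = p
    approx-constant {i} {suc d} i≤1+d p with ℕₚ.m≤n⇒m<n∨m≡n i≤1+d
    ... | inj₁ (s≤s i≤d) = cong step (approx-constant i≤d p)
    ... | inj₂ refl      = p

    -- If the step from `d` to `suc d` were strict, so would be all earlier ones, because equality
    -- once reached persists. The first `d + 2` approximations would then form a chain longer than
    -- `d`.
    approx-stable : ∀ {d} → LongestChainLength x d → approx d ≡ approx (suc d)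
    approx-stable {d} (_ , bounded) with Vecₚ.≡-dec _≟_ (approx d) (approx (suc d))
    ... | yes p = p
    ... | no ¬p = ⊥-elim (ℕₚ.<-irrefl refl (ℕₚ.≤-trans (ℕₚ.n≤1+n _)
        (subst (_≤ d) (Listₚ.length-applyUpTo approx (suc (suc d)))
          (bounded (applyUpTo approx (suc (suc d)))
            (applyUpTo⁺₁ approx (suc (suc d)) λ {i} i<1+d →
              approx-up i , λ p → ¬p (approx-constant (ℕₚ.≤-pred (ℕₚ.≤-pred i<1+d)) p))))))

    -- The circuit `h⁰` already applies `h` once, to `•`; hence the unrolled circuit with index `k`
    -- is `h` at the Kleene approximation of the same index.
    eval-iterate : ∀ k → eval (iterate {x} {a} {b} h k) s ≡ eval h (approx k ++ s)
    eval-iterate zero    = cong (λ u → eval h (u ++ s)) (eval-intros x (take 0 s))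
    eval-iterate (suc k) = cong (eval h) (trans
      (cong (eval (f ⊗ id a)) (eval-forks s))
      (trans (eval-⊗ f (id a) s s) (cong (_++ s) fed)))
      where
      f : CCirc a x
      f = iterate {x} {a} {b} h k ⨟ (id x ⊗ elims b) ⨟ coeᶜ (ℕₚ.+-identityʳ x)
      fed : eval f s ≡ approx (suc k)
      fed = trans (eval-coe (ℕₚ.+-identityʳ x) _)
        (trans (++-identityʳ-subst _ _) (cong (take x) (eval-iterate k)))

  if-sound : ∀ x {a b} (h : CCirc (x + a) (x + b)) d → LongestChainLength x d →
    SameDenotation (Tr x ⌜ h ⌝) (⌜ iterate {x} {a} {b} h (suc d) ⌝ ⨟ (⌜ elims x ⌝ ⊗ id b))
  if-sound x {a} {b} h d longest σ =
    trace-eval x {F = ⟦ ⌜ h ⌝ ⟧} {ν = ν} record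
      { fixed = λ k → trans (looped ν k) (sym (cong (λ u → take x (eval h (u ++ σ k))) (stable k)))
      ; least = λ τ p k → below τ p (suc d) k
      } ⊙
    (λ k → trans (cong (drop x) (eval-denotes h (ν ++ˢ σ) k))
             (trans (cong (drop x) (sym (eval-iterate h (σ k) (suc d))))
                    (sym (eval-denotes-out k))))
    where
    ν : Stream x
    -- The loop has no memory, so its least fixed point is found separately at each tick.
    ν k = approx h (σ k) (suc d)
    stable : ∀ k → approx h (σ k) d ≡ approx h (σ k) (suc d)
    stable k = approx-stable h (σ k) longest
    looped : ∀ τ k → loop x ⟦ ⌜ h ⌝ ⟧ σ τ k ≡ take x (eval h (τ k ++ σ k))
    looped τ k = cong (take x) (eval-denotes h (τ ++ˢ σ) k)
    below : ∀ τ → loop x ⟦ ⌜ h ⌝ ⟧ σ τ ⊑ˢ τ → ∀ j k → approx h (σ k) j ⊑ᵛ τ k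
    below τ p zero    k = ⊑ᵛ-minimum _
    below τ p (suc j) k = ⊑ᵛ-trans (step-mono h (σ k) (below τ p j k))
                                   (subst (_⊑ᵛ τ k) (looped τ k) (p k))
    h′ = iterate {x} {a} {b} h (suc d) ⨟ (elims x ⊗ id b)
    eval-denotes-out : ∀ k → denotes ⌜ h′ ⌝ σ k ≡ drop x (eval (iterate {x} {a} {b} h (suc d)) (σ k))
    eval-denotes-out k = trans (eval-denotes h′ σ k)
      (cong (_++ drop x (eval (iterate {x} {a} {b} h (suc d)) (σ k))) ([]-unique _))

  rule-sound : ∀ {r} {f g : SCirc m n} → f ▷[ r ] g → SameDenotation f g
  rule-sound (mealy x y z f̂ vs) = mealy-sound x y z f̂ vs
  rule-sound (if x h d ld)      = if-sound x h d ld
  rule-sound (str h vs)         = str-sound h vs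
  rule-sound (v-fork v) σ       =
    sound (⨟-congˡ {g = gen (comb fork)} (≈-sym (values₁ {v}))) σ ⊙
    values-eval-denotes (gen fork) (v ∷ []) σ ⊙
    sound (⊗-cong (≈-refl {f = value v}) (values₁ {v})) σ
  rule-sound (v-join v w) σ     =
    sound (⨟-congˡ {g = gen (comb join)}
      (⊗-cong (≈-refl {f = value v}) (≈-sym (values₁ {w})))) σ ⊙
    values-eval-denotes (gen join) (v ∷ w ∷ []) σ ⊙
    sound (values₁ {v ⊔ w}) σ
  rule-sound (v-elim v) σ       =
    sound (⨟-congˡ {g = gen (comb elim)} (≈-sym (values₁ {v}))) σ ⊙
    values-eval-denotes (gen elim) (v ∷ []) σ
  rule-sound (v-prim p vs)      = values-eval-denotes (gen (prim p)) vs

  ⟶-sound : ∀ {r} {f g : SCirc m n} → f ⟶[ r ] g → SameDenotation f g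
  ⟶-sound (rule p)      = rule-sound p
  ⟶-sound (mod p q r) σ = sound p σ ⊙ ⟶-sound q σ ⊙ sound r σ
  ⟶-sound (⨟ˡ {g = g} p) σ = resp ⟦ g ⟧ (⟶-sound p σ)
  ⟶-sound (⨟ʳ {f = f} p) σ = ⟶-sound p (denotes f σ)
  ⟶-sound (⊗ˡ {m = m} {g = g} p) σ = ++ˢ-cong (⟶-sound p (takeˢ m σ)) (≗-refl (denotes g (dropˢ m σ)))
  ⟶-sound (⊗ʳ {m = m} {f = f} p) σ = ++ˢ-cong (≗-refl (denotes f (takeˢ m σ))) (⟶-sound p (dropˢ m σ))
  ⟶-sound (tr {x} {f = f} {f′} p) = trace-cong x {⟦ f ⟧} {⟦ f′ ⟧} (⟶-sound p)

  star-sound : ∀ {r} {f g : SCirc m n} → Star (_⟶[ r ]_) f g → SameDenotation f g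
  star-sound ε        σ = ≗-refl _
  star-sound (p ◅ ps) σ = ⟶-sound p σ ⊙ star-sound ps σ

  -- At tick 0 this determines `w` from `f` and `v`; at later ticks it determines `f′` up to
  -- denotation.
  productive-sound : ∀ {f f′ : SCirc m n} {v w} → Productive f v f′ w →
                     ∀ σ → denotes f (cons v σ) ≗ˢ cons w (denotes f′ σ)
  productive-sound {f = f} {f′} {v} {w} (_ , _ , _ , p , q , r , s) σ =
    resp ⟦ f ⟧ (≗-sym (reg-denotes v σ)) ⊙
    ⟶-sound p σ ⊙ ⟶-sound q σ ⊙ ⟶-sound r σ ⊙ star-sound s σ ⊙
    reg-denotes w (denotes f′ σ)

-- Longest chains in finite powers of the lattice.

-- Quantifying over all decidable predicates lets searchability pass from `V` to vectors and again
-- to vectors of vectors, which is where chains live.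
Searchable : Set → Set₁
Searchable A = ∀ {P : A → Set} → U.Decidable P → Dec (∃[ a ] P a)

searchable-Vec : ∀ {A n} → Searchable A → Searchable (Vec A n)
searchable-Vec {n = zero}  search P? = map′ (λ p → [] , p) (λ { ([] , p) → p }) (P? [])
searchable-Vec {n = suc n} search P? =
  map′ (λ { (a , as , p) → a ∷ as , p }) (λ { (a ∷ as , p) → a , as , p })
       (search λ a → searchable-Vec search λ as → P? (a ∷ as))

greatest : ∀ {P : ℕ → Set} → U.Decidable P → P 0 → ∀ N → (∀ d → P d → d ≤ N) →
           ∃[ d ] P d × (∀ e → P e → e ≤ d)
greatest P? p₀ zero    bounded = 0 , p₀ , bounded
greatest P? p₀ (suc N) bounded with P? (suc N)
... | yes p = suc N , p , bounded
... | no ¬p = greatest P? p₀ N λ d p →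
  ℕₚ.≤-pred (ℕₚ.≤∧≢⇒< (bounded d p) λ { refl → ¬p p })

lookup-injective : ∀ {A : Set} {xs : List A} → AllPairs _≢_ xs →
                   ∀ {i j} → List.lookup xs i ≡ List.lookup xs j → i ≡ j
lookup-injective (_ ∷ _)   {zero}  {zero}  e = refl
lookup-injective (px ∷ _)  {zero}  {suc j} e = ⊥-elim (All.lookup px (∈-lookup j) e)
lookup-injective (px ∷ _)  {suc i} {zero}  e = ⊥-elim (All.lookup px (∈-lookup i) (sym e))
lookup-injective (_ ∷ pxs) {suc i} {suc j} e = cong suc (lookup-injective pxs e)

module Chains (S : Signature) (I : Interpretation S) where
  open Signature S
  open Interpretation I
  open Denotation S I
  open Reduction S I
  private module L = IsLattice isLattice

  searchable-V : Searchable V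
  searchable-V {P} P? =
    map′ (λ { (i , p) → Inverse.from finite i , p })
         (λ { (v , p) → toFin v , subst P (sym (Inverse.strictlyInverseʳ finite v)) p })
         (Finₚ.any? (P? ∘ Inverse.from finite))

  -- The order is recovered from the join: `u ⊑ v` exactly when `u ⊔ v ≡ v`, and equality on `V` is
  -- decidable.
  _⊑?_ : Decidable _⊑_
  u ⊑? v = map′ (λ p → subst (u ⊑_) p (L.x≤x∨y u v))
                (λ p → L.antisym (L.∨-least p L.refl) (L.y≤x∨y u v)) ((u ⊔ v) ≟ v)

  isChain? : ∀ {x} → U.Decidable (IsChain {x})
  isChain? = linked? (NonStrictToStrict.<-decidable _≡_ _⊑ᵛ_ (Vecₚ.≡-dec _≟_) (Pointwise.decidable _⊑?_))

  code : ∀ {x} → Vec V x → Fin (card ^ x)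
  code us = funToFin (toFin ∘ lookup us)

  code-injective : ∀ {x} {us vs : Vec V x} → code us ≡ code vs → us ≡ vs
  code-injective {us = us} {vs} e =
    trans (sym (Vecₚ.tabulate∘lookup us)) (trans (Vecₚ.tabulate-cong λ i → toFin-injective
      (trans (sym (Finₚ.finToFun-funToFin (toFin ∘ lookup us) i))
        (trans (cong (λ c → finToFun c i) e) (Finₚ.finToFun-funToFin (toFin ∘ lookup vs) i))))
      (Vecₚ.tabulate∘lookup vs))

  ⊑ᵛ-isPartialOrder : ∀ {x} → IsPartialOrder _≡_ (_⊑ᵛ_ {x})
  ⊑ᵛ-isPartialOrder = record
    { isPreorder = record
      { isEquivalence = isEquivalence
      ; reflexive = λ { refl → ⊑ᵛ-refl }
      ; trans = ⊑ᵛ-trans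
      }
    ; antisym = ⊑ᵛ-antisym
    }

  -- By transitivity of the strict order the entries of a chain are pairwise distinct, so indices
  -- inject into the codes of vectors.
  chain-bounded : ∀ {x} (us : List (Vec V x)) → IsChain us → length us ≤ card ^ x
  chain-bounded us chain = Finₚ.injective⇒≤ {f = code ∘ List.lookup us}
    (lookup-injective (AllPairs.map proj₂
      (Linked⇒AllPairs (NonStrictToStrict.<-trans _≡_ _⊑ᵛ_ ⊑ᵛ-isPartialOrder) chain)) ∘ code-injective)

  -- At a fixed length chains are vectors of vectors, so their existence is decidable; the empty
  -- chain and `card ^ x` delimit the search for the greatest length.
  longestChain : ∀ x → ∃[ d ] LongestChainLength x d
  longestChain x with greatest {HasChain} hasChain? ([] , []) (card ^ x) bounded
    where
    HasChain : ℕ → Set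
    HasChain d = ∃[ us ] IsChain {x} (toList {n = d} us)
    hasChain? : U.Decidable HasChain
    hasChain? d = searchable-Vec (searchable-Vec searchable-V) (isChain? ∘ toList)
    bounded : ∀ d → HasChain d → d ≤ card ^ x
    bounded d (us , chain) = subst (_≤ card ^ x) (Vecₚ.length-toList us) (chain-bounded _ chain)
  ... | d , (us , chain) , maximal =
    d , (toList us , chain , Vecₚ.length-toList us) ,
    λ vs chain′ → maximal (length vs) (fromList vs , subst IsChain (sym (Vecₚ.toList∘fromList vs)) chain′)

-- Observational equivalence is equality of denotations.

n<m^n : ∀ {m} → 2 ≤ m → ∀ n → n < m ^ n
n<m^n           2≤m zero    = s≤s z≤n
n<m^n {m = m}   2≤m (suc n) = ℕₚ.≤-trans
  (ℕₚ.≤-trans (ℕₚ.m≤n+m (2 + n) n) (ℕₚ.≤-reflexive (trans (ℕₚ.+-suc n (suc n)) (cong (suc n +_) (sym (ℕₚ.+-identityʳ (suc n)))))))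
  (ℕₚ.≤-trans (ℕₚ.*-monoʳ-≤ 2 (n<m^n 2≤m n)) (ℕₚ.*-monoˡ-≤ (m ^ n) 2≤m))

-- For at least two values the length `card ^ c + 1` outgrows every tick as `c` grows; for one value
-- it does not grow at all, but then there is nothing to compare.
subsingleton⊎large : ∀ {n} → Fin n → (∀ (i j : Fin n) → i ≡ j) ⊎ 2 ≤ n
subsingleton⊎large {suc zero}    _ = inj₁ λ { zero zero → refl }
subsingleton⊎large {suc (suc n)} _ = inj₂ (s≤s (s≤s z≤n))

module Observation (S : Signature) (I : Interpretation S) where
  open Signature S
  open Circuits S
  open Denotation S I
  open Reduction S I
  open Productivity S I using (productive)
  open Soundness S I
  open RuleSoundness S I using (productive-sound; ⊥ⁿ)
  open Chains S I using (longestChain)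

  abstract
    round : ∀ {m n} (f : SCirc m n) (v : Vec V m) → ∃[ f′ ] ∃[ w ] Productive f v f′ w
    round = productive longestChain

  produces : ∀ {m n k} (f : SCirc m n) (vs : Vec (Vec V m) k) → ∃[ ws ] Produces f vs ws
  produces f []       = [] , []
  produces f (v ∷ vs) with round f v
  ... | f′ , w , p with produces f′ vs
  ... | ws , ps = w ∷ ws , p ∷ ps

  Produces-denotes : ∀ {m n} k {f : SCirc m n} (σ : Stream m) {ws} →
    Produces {k = k} f (tabulate (σ ∘ toℕ)) ws → ∀ i → lookup ws i ≡ denotes f σ (toℕ i)
  Produces-denotes (suc k) {f} σ (_∷_ {f′ = f′} {w = w} p ps) i =
    trans (at i) (resp ⟦ f ⟧ (λ { zero → refl ; (suc j) → refl }) (toℕ i))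
    where
    tail : Stream _
    tail = σ ∘ suc
    at : ∀ i → lookup (w ∷ _) i ≡ denotes f (cons (σ 0) tail) (toℕ i)
    at zero    = sym (productive-sound p tail 0)
    at (suc i) = trans (Produces-denotes k tail ps i) (sym (productive-sound p tail (suc (toℕ i))))

  -- The rounds of `f` are not replayed. `g` has rounds of its own, and soundness on both sides
  -- forces their outputs to agree and keeps the successors equal in denotation.
  Produces-transfer : ∀ {m n k} {f g : SCirc m n} {vs : Vec (Vec V m) k} {ws} →
    SameDenotation f g → Produces f vs ws → Produces g vs ws
  Produces-transfer e [] = []
  Produces-transfer {f = f} {g} e (_∷_ {f′ = f′} {v} {w} p ps) with round g v
  ... | g′ , w′ , q =
    -- At tick 0 both sides are independent of the later input, so any stream serves as a witness.
    subst (Productive g v g′) (sym (same (λ _ → ⊥ⁿ) 0)) q ∷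
    Produces-transfer (λ σ k → same σ (suc k)) ps
    where
    same : ∀ σ → cons w (denotes f′ σ) ≗ˢ cons w′ (denotes g′ σ)
    same σ = ≗-sym (productive-sound p σ) ⊙ e (cons v σ) ⊙ productive-sound q σ

  SameDenotation⇒∼ : ∀ {m n} {f g : SCirc m n} → SameDenotation f g → f ∼ g
  SameDenotation⇒∼ e c _ _ vs ws =
    mk⇔ (Produces-transfer e) (Produces-transfer λ σ → ≗-sym (e σ))

  Vec-subsingleton : (∀ (u v : V) → u ≡ v) → ∀ {n} (us vs : Vec V n) → us ≡ vs
  Vec-subsingleton eq []       []       = refl
  Vec-subsingleton eq (u ∷ us) (v ∷ vs) = cong₂ _∷_ (eq u v) (Vec-subsingleton eq us vs)

  ∼⇒SameDenotation : ∀ {m n} {f g : SCirc m n} → f ∼ g → SameDenotation f g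
  ∼⇒SameDenotation {m} {f = f} {g} f∼g σ k with subsingleton⊎large (toFin •)
  ... | inj₁ eq  = Vec-subsingleton (λ u v → toFin-injective (eq (toFin u) (toFin v))) _ _
  ... | inj₂ 2≤N = subst (λ j → denotes f σ j ≡ denotes g σ j) (Finₚ.toℕ-fromℕ< k<K)
    (trans (sym (Produces-denotes K σ pf i)) (Produces-denotes K σ pg i))
    where
    -- The delay counts make `c` an admissible bound for both circuits; the summand `k` makes the
    -- waveform reach tick `k`.
    c = delays f + delays g + k
    K = card ^ c + 1
    k<K : k < K
    k<K = ℕₚ.≤-trans (s≤s (ℕₚ.m≤n+m k (delays f + delays g)))
            (ℕₚ.≤-trans (n<m^n 2≤N c) (ℕₚ.m≤m+n (card ^ c) 1))
    i = fromℕ< k<K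
    vs : Vec (Vec V m) K
    vs = tabulate (σ ∘ toℕ)
    ws = proj₁ (produces f vs)
    pf : Produces f vs ws
    pf = proj₂ (produces f vs)
    f≤c : delays f ≤ c
    f≤c = ℕₚ.≤-trans (ℕₚ.m≤m+n (delays f) (delays g)) (ℕₚ.m≤m+n _ k)
    g≤c : delays g ≤ c
    g≤c = ℕₚ.≤-trans (ℕₚ.m≤n+m (delays g) (delays f)) (ℕₚ.m≤m+n _ k)
    pg : Produces g vs ws
    pg = Equivalence.to (f∼g c f≤c g≤c vs ws) pf

  -- Every clause passes through denotations, which are compositional; a direct argument on output
  -- waveforms would have to relate the rounds of a composite to those of its parts.
  ∼-isCongruence : IsCongruence _∼_
  ∼-isCongruence = record
    { respects-≈ = λ f≈f′ g≈g′ f∼g → SameDenotation⇒∼ λ σ →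
        ≗-sym (sound f≈f′ σ) ⊙ ∼⇒SameDenotation f∼g σ ⊙ sound g≈g′ σ
    ; reflexive = SameDenotation⇒∼ λ σ k → refl
    ; symmetric = λ f∼g → SameDenotation⇒∼ λ σ → ≗-sym (∼⇒SameDenotation f∼g σ)
    ; transitive = λ f∼g g∼h → SameDenotation⇒∼ λ σ →
        ∼⇒SameDenotation f∼g σ ⊙ ∼⇒SameDenotation g∼h σ
    ; ⨟-preserved = λ {_} {_} {_} {_} {f′} {g} f∼f′ g∼g′ → SameDenotation⇒∼ λ σ →
        resp ⟦ g ⟧ (∼⇒SameDenotation f∼f′ σ) ⊙ ∼⇒SameDenotation g∼g′ (denotes f′ σ)
    ; ⊗-preserved = λ {m} f∼f′ g∼g′ → SameDenotation⇒∼ λ σ →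
        ++ˢ-cong (∼⇒SameDenotation f∼f′ (takeˢ m σ)) (∼⇒SameDenotation g∼g′ (dropˢ m σ))
    ; Tr-preserved = λ {x} {_} {_} {f} {f′} f∼f′ → SameDenotation⇒∼
        (trace-cong x {⟦ f ⟧} {⟦ f′ ⟧} (∼⇒SameDenotation f∼f′))
    }

corollary5p40 : ∀ {ℓ : Level} (S : Signature) (I : Interpretation S) →
    let open Circuits S
        open Denotation S I
        open Reduction S I
    in (IsCongruence _∼_ × Adequate _∼_) ×
       (∀ (R : CircuitRelation ℓ) → IsCongruence R → Adequate R →
          ∀ {m n} {f g : SCirc m n} → R f g → f ∼ g)
corollary5p40 S I =
  (∼-isCongruence , ∼⇒SameDenotation) , λ R _ adequate r → SameDenotation⇒∼ (adequate r)
  where open Observation S I
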